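{- Let $\mathcal{P}\subseteq2^\omega$ be a nonempty $\Pi^0_1$ class. Then $X\in2^\omega$ is a randomly produced path through $T_{\mathcal{P}}$ if and only if $X$ is $T_{\mathcal{P}}$-Martin-Löf random with respect to $\mu_{\mathcal{P}}$, i.e. $X\in\mathsf{MLR}^{T_{\mathcal{P}}}_{\mu_{\mathcal{P}}}$.
   Context: Notation: $2^\omega$ is the set of infinite binary sequences, $2^{<\omega}$ the set of finite binary strings, $\epsilon$ the empty string, $X\upharpoonright n$ the initial segment of length $n$, $[\![\sigma]\!]=\{X\in2^\omega:\sigma\prec X\}$, and $\lambda$ the Lebesgue measure on $2^\omega$. A $\Pi^0_1$ class is the set of infinite paths through a computable tree $T\subseteq2^{<\omega}$. For a closed set $\mathcal{P}$, $T_{\mathcal{P}}=\{\sigma:\mathcal{P}\cap[\![\sigma]\!]\neq\emptyset\}$. Martin-Löf randomness: for an oracle $A$ and a probability measure $\mu$ on $2^\omega$, $\mathsf{MLR}^A_\mu$ is the set of $X$ such that $X\notin\bigcap_n\mathcal{U}_n$ for every uniformly $A$-c.e. sequence of open sets $(\mathcal{U}_n)$ with $\mu(\mathcal{U}_n)\le2^{ -n}$ for all $n$; $\mathsf{MLR}^A=\mathsf{MLR}^A_\lambda$. Randomly produced paths: for $R\in2^\omega$, $\Psi_{\mathcal{P}}(R)\in\mathcal{P}$ is the sequence $X$ built recursively as follows. Given $\sigma=X\upharpoonright m\in T_{\mathcal{P}}$, let $n$ be the number of bits of $R$ used so far, i.e. the number of $j<m$ such that both one-bit extensions of $X\upharpoonright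 j$ lie in $T_{\mathcal{P}}$. If only one $i\in\{0,1\}$ satisfies $\sigma i\in T_{\mathcal{P}}$, put $X(m)=i$; if both $\sigma0,\sigma1\in T_{\mathcal{P}}$, put $X(m)=R(n)$. The randomly produced paths through $T_{\mathcal{P}}$ are the members of $\{\Psi_{\mathcal{P}}(R):R\in\mathsf{MLR}^{T_{\mathcal{P}}}\}$. The measure $\mu_{\mathcal{P}}$: define $\phi:2^{<\omega}\to T_{\mathcal{P}}$ by $\phi(\epsilon)=\epsilon$ and, for each $\sigma$: if $\phi(\sigma)0$ and $\phi(\sigma)1$ are both in $T_{\mathcal{P}}$, then $\phi(\sigma i)=\phi(\sigma)i$ for $i\in\{0,1\}$; if $\phi(\sigma)i\notin T_{\mathcal{P}}$ for some $i$ (so $\phi(\sigma)(1-i)\in T_{\mathcal{P}}$), then $\phi(\sigma0)=\phi(\sigma1)=\phi(\sigma)(1-i)$. Let $\Phi_{\mathcal{P}}(X)=\bigcup_n\phi(X\upharpoonright n)$, a total $T_{\mathcal{P}}$-computable functional $2^\omega\to\mathcal{P}$. Then $\mu_{\mathcal{P}}$ is the induced measure, $\mu_{\mathcal{P}}([\![\sigma]\!])=\lambda(\{X:\sigma\prec\Phi_{\mathcal{P}}(X)\})$. -}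

module Defs where

open import Axiom.ExcludedMiddle using (ExcludedMiddle)
open import Data.Bool.Base using (Bool; true; false; not; if_then_else_)
open import Data.Fin.Base using (Fin)
open import Data.Nat.Base using (ℕ; zero; suc; _+_; _*_; _<_)
open import Data.Product.Base using (_×_; ∃-syntax; Σ-syntax)
open import Data.Rational.Base as ℚ using (ℚ; 0ℚ; 1ℚ; ½)
open import Data.Vec.Base using (Vec; []; _∷_; lookup)
open import Data.Vec.Relation.Binary.Pointwise.Inductive using (Pointwise)
open import Function.Bundles using (_⇔_)
open import Level using (0ℓ) renaming (suc to lsuc)
open import Relation.Binary.PropositionalEquality using (_≡_; refl; cong; _≗_)
open import Relation.Nullary using (¬_; does)
open import Relation.Unary using (Pred; _∈_; _∉_; ∅)

------------------------------------------------------------------------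
-- Binary strings and sequences

Cantor : Set
Cantor = ℕ → Bool

infixl 6 _▹_

-- σ ▹ i is the string σi: the last bit is outermost.
data String : Set where
  ε   : String
  _▹_ : String → Bool → String

∣_∣ : String → ℕ
∣ ε ∣     = 0
∣ σ ▹ _ ∣ = suc ∣ σ ∣

infixl 7 _↾_

_↾_ : Cantor → ℕ → String
X ↾ zero  = ε
X ↾ suc n = X ↾ n ▹ X n

infix 4 _≺_

_≺_ : String → Cantor → Set
σ ≺ X = X ↾ ∣ σ ∣ ≡ σ

⟦_⟧ : String → Pred Cantor 0ℓ
⟦ σ ⟧ X = σ ≺ X

-- The length-lexicographic bijection between strings and ℕ.
code : String → ℕ
code ε           = 0
code (σ ▹ false) = 1 + 2 * code σ
code (σ ▹ true)  = 2 + 2 * code σ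

------------------------------------------------------------------------
-- Partial recursive functions relative to an oracle (Kleene's schemes)

data Rec : ℕ → Set where
  zero   : Rec 0
  succ   : Rec 1
  proj   : ∀ {n} → Fin n → Rec n
  oracle : Rec 1
  comp   : ∀ {m n} → Rec m → Vec (Rec n) m → Rec n
  prec   : ∀ {n} → Rec n → Rec (2 + n) → Rec (1 + n)
  μ-min  : ∀ {n} → Rec (1 + n) → Rec n

infix 4 _⊢_·_⇓_

-- A ⊢ e · xs ⇓ y : with oracle A, the program e halts on xs with value y.
data _⊢_·_⇓_ (A : Pred String 0ℓ) : ∀ {n} → Rec n → Vec ℕ n → ℕ → Set where
  zero⇓  : A ⊢ zero · [] ⇓ 0
  succ⇓  : ∀ {x} → A ⊢ succ · (x ∷ []) ⇓ suc x
  proj⇓  : ∀ {n} {i : Fin n} {xs} → A ⊢ proj i · xs ⇓ lookup xs i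
  yes⇓   : ∀ {σ} → σ ∈ A → A ⊢ oracle · (code σ ∷ []) ⇓ 1
  no⇓    : ∀ {σ} → σ ∉ A → A ⊢ oracle · (code σ ∷ []) ⇓ 0
  comp⇓  : ∀ {m n} {f : Rec m} {gs : Vec (Rec n) m} {xs ys z} →
           Pointwise (λ g y → A ⊢ g · xs ⇓ y) gs ys →
           A ⊢ f · ys ⇓ z →
           A ⊢ comp f gs · xs ⇓ z
  prec0⇓ : ∀ {n} {f : Rec n} {g xs y} →
           A ⊢ f · xs ⇓ y →
           A ⊢ prec f g · (0 ∷ xs) ⇓ y
  precS⇓ : ∀ {n} {f : Rec n} {g k xs y z} →
           A ⊢ prec f g · (k ∷ xs) ⇓ y →
           A ⊢ g · (k ∷ y ∷ xs) ⇓ z →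
           A ⊢ prec f g · (suc k ∷ xs) ⇓ z
  min⇓   : ∀ {n} {f : Rec (1 + n)} {xs k} →
           (∀ j → j < k → ∃[ y ] A ⊢ f · (j ∷ xs) ⇓ suc y) →
           A ⊢ f · (k ∷ xs) ⇓ 0 →
           A ⊢ μ-min f · xs ⇓ k

infix 4 _⊢_·_↓

_⊢_·_↓ : ∀ (A : Pred String 0ℓ) {n} → Rec n → Vec ℕ n → Set
A ⊢ e · xs ↓ = ∃[ y ] A ⊢ e · xs ⇓ y

Computable : Pred String 0ℓ → Set
Computable S = ∃[ e ] ∀ σ →
  (σ ∈ S → ∅ ⊢ e · (code σ ∷ []) ⇓ 1) ×
  (σ ∉ S → ∅ ⊢ e · (code σ ∷ []) ⇓ 0)

-- Uₙ is the union of the cylinders ⟦ σ ⟧ with (n , σ) in a single A-c.e. set,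
-- an A-c.e. set being the domain of a partial A-recursive function.
UniformlyCEOpen : Pred String 0ℓ → (ℕ → Pred Cantor 0ℓ) → Set
UniformlyCEOpen A U = ∃[ e ] ∀ n X →
  X ∈ U n ⇔ (∃[ σ ] (A ⊢ e · (n ∷ code σ ∷ []) ↓) × X ∈ ⟦ σ ⟧)

------------------------------------------------------------------------
-- Π⁰₁ classes

IsTree : Pred String 0ℓ → Set
IsTree T = ∀ σ i → σ ▹ i ∈ T → σ ∈ T

IsΠ⁰₁ : Pred Cantor 0ℓ → Set₁
IsΠ⁰₁ P = ∃[ T ] IsTree T × Computable T × (∀ X → X ∈ P ⇔ (∀ n → X ↾ n ∈ T))

T⟨_⟩ : Pred Cantor 0ℓ → Pred String 0ℓ
T⟨ P ⟩ σ = ∃[ X ] X ∈ P × X ∈ ⟦ σ ⟧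

------------------------------------------------------------------------
-- Measure

-- A [0,∞]-valued set function μ is given by the rational upper bounds of its
-- values: μ S q says μ(S) ≤ q.
SetFunction : Set₁
SetFunction = Pred Cantor 0ℓ → ℚ → Set

2⁻_ : ℕ → ℚ
2⁻ zero  = 1ℚ
2⁻ suc n = ½ ℚ.* (2⁻ n)

∑< : ℕ → (ℕ → ℚ) → ℚ
∑< zero    a = 0ℚ
∑< (suc k) a = ∑< k a ℚ.+ a k

-- Lebesgue (outer) measure: the infimum of ∑ᵢ 2^{-|σᵢ|} over the countable
-- covers of S by cylinders ⟦ σᵢ ⟧.
lebesgue : SetFunction
lebesgue S q = ∀ δ → 0ℚ ℚ.< δ → Σ[ C ∈ (ℕ → String) ]
  (∀ X → X ∈ S → ∃[ i ] X ∈ ⟦ C i ⟧) ×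
  (∀ k → ∑< k (λ i → 2⁻ ∣ C i ∣) ℚ.≤ q ℚ.+ δ)

-- The set function induced by F: S ↦ μ(F⁻¹(S)).
pushforward : (Cantor → Cantor) → SetFunction → SetFunction
pushforward F μ S = μ (λ X → F X ∈ S)

-- Used only for Lebesgue measure and the measure it induces along Φ, where
-- the sets U n are open and hence measurable (also after pulling back).
MLR : Pred String 0ℓ → SetFunction → Pred Cantor (lsuc 0ℓ)
MLR A μ X = ∀ U → UniformlyCEOpen A U → (∀ n → μ (U n) (2⁻ n)) → ¬ (∀ n → X ∈ U n)

------------------------------------------------------------------------
-- Paths through T⟨ P ⟩. Excluded middle serves to define functions by cases
-- on membership in T⟨ P ⟩, which is not decidable in general.

module _ (em : ExcludedMiddle 0ℓ) (P : Pred Cantor 0ℓ) where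

  branching : String → Bool
  branching σ = does (em {(σ ▹ false ∈ T⟨ P ⟩) × (σ ▹ true ∈ T⟨ P ⟩)})

  -- The bit by which σ ∈ T⟨ P ⟩ is extended: b if there is a choice, and
  -- otherwise the only i with σi ∈ T⟨ P ⟩.
  next : String → Bool → Bool
  next σ b = if branching σ then b else not (does (em {σ ▹ false ∈ T⟨ P ⟩}))

  #branchings : String → ℕ
  #branchings ε       = 0
  #branchings (σ ▹ _) = (if branching σ then 1 else 0) + #branchings σ

  ψ : Cantor → ℕ → String
  ψ R zero    = ε
  ψ R (suc m) = ψ R m ▹ next (ψ R m) (R (#branchings (ψ R m)))

  Ψ : Cantor → Cantor
  Ψ R m = next (ψ R m) (R (#branchings (ψ R m)))

  Ψ-↾ : ∀ R m → Ψ R ↾ m ≡ ψ R m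
  Ψ-↾ R zero    = refl
  Ψ-↾ R (suc m) = cong (_▹ Ψ R m) (Ψ-↾ R m)

  -- Sequences are functions, so membership in the image is up to _≗_.
  RandomlyProduced : Pred Cantor (lsuc 0ℓ)
  RandomlyProduced X = ∃[ R ] R ∈ MLR T⟨ P ⟩ lebesgue × X ≗ Ψ R

  φ : String → String
  φ ε       = ε
  φ (σ ▹ i) = φ σ ▹ next (φ σ) i

  -- ⋃ₙ φ (X ↾ n): its n-th bit is the last bit of φ (X ↾ suc n); see Φ-↾.
  Φ : Cantor → Cantor
  Φ X n = next (φ (X ↾ n)) (X n)

  Φ-↾ : ∀ X n → Φ X ↾ n ≡ φ (X ↾ n)
  Φ-↾ X zero    = refl
  Φ-↾ X (suc n) = cong (_▹ Φ X n) (Φ-↾ X n)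

  inducedMeasure : SetFunction
  inducedMeasure = pushforward Φ lebesgue

{-# OPTIONS --safe #-}

-- Ψ and Φ produce the same path when the bits that Ψ reads are the ones that
-- Φ does not ignore, so λ(Φ⁻¹U) = λ(Ψ⁻¹U), and tests are transferred along
-- R ↦ Ψ R and X ↦ (the bits of X at its branchings), which T⟨ P ⟩ computes.
-- The equality of measures is a pair of inequalities between outer measures:
--
-- * A cover of Φ⁻¹U pulls back along R ↦ merge R Z to a cover of Ψ⁻¹U, where Z
--   supplies the ignored bits. Averaged over Z the total weight does not
--   change, so some Z does not increase it.
-- * A cylinder of a cover of Ψ⁻¹U pulls back along Y ↦ (the bits of Y that Φ
--   does not ignore) to a set of at most the same measure, by Kolmogorov's
--   inequality. To make this sequence of bits infinite, all bits after the last
--   branching are counted as well.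
--
-- A μ-random X with only finitely many branchings is Ψ R for every R extending
-- a certain string, and among these R there is a random one, since there are
-- only countably many tests.

module Submission where

open import Axiom.ExcludedMiddle using (ExcludedMiddle)
open import Data.Bool.Base using (Bool; true; false; not; if_then_else_; _∧_; _∨_)
import Data.Bool.Properties as Bool
open import Data.Fin.Base as Fin using (Fin)
open import Data.Fin.Patterns using (0F; 1F; 2F; 3F)
import Data.Fin.Properties as Fin
import Data.Integer.Base as ℤ
import Data.Integer.Properties as ℤ
open import Data.Maybe.Base as Maybe using (Maybe; just; nothing; fromMaybe; _>>=_)
open import Data.Maybe.Properties using (just-injective)
open import Data.Nat.Base as ℕ using (ℕ; zero; suc; _+_; _*_; _∸_; _≤_; _<_; z≤n; s≤s)
import Data.Nat.Properties as ℕ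
open import Data.Product.Base using (_×_; _,_; proj₁; proj₂; ∃-syntax; Σ-syntax)
open import Data.Rational.Base as ℚ using (ℚ; 0ℚ; 1ℚ; ½; mkℚ)
import Data.Rational.Properties as ℚ
open import Data.Rational.Solver using (module +-*-Solver)
import Data.Rational.Unnormalised.Base as ℚᵘ
import Data.Rational.Unnormalised.Properties as ℚᵘ
open import Data.Sum.Base using (_⊎_; inj₁; inj₂; [_,_]′)
open import Data.Vec.Base using (Vec; []; _∷_; lookup; tabulate)
open import Data.Vec.Properties using (tabulate∘lookup)
open import Data.Vec.Relation.Binary.Pointwise.Inductive as Pointwise using (Pointwise; []; _∷_)
open import Function.Bundles using (_⇔_; mk⇔; Equivalence)
open import Level using (0ℓ)
open import Relation.Binary.Definitions using (tri<; tri≈; tri>)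
open import Relation.Binary.PropositionalEquality
  using (_≡_; _≢_; refl; sym; trans; cong; cong₂; subst; subst₂; _≗_; module ≡-Reasoning)
open import Relation.Nullary using (¬_; Dec; yes; no; does; contradiction)
open import Relation.Nullary.Decidable using (dec-true; dec-false)
open import Relation.Unary using (Pred; _∈_; _∉_; _⊆_; Satisfiable)
open import Defs

open +-*-Solver using (solve; con; _:+_; _:*_; _:-_; _:=_)

-- Sums, strings and codes

p≤q⇒0≤q-p : ∀ {p q} → p ℚ.≤ q → 0ℚ ℚ.≤ q ℚ.- p
p≤q⇒0≤q-p {p} {q} p≤q =
  subst (ℚ._≤ q ℚ.- p) (ℚ.+-inverseʳ p) (ℚ.+-monoˡ-≤ (ℚ.- p) p≤q)

p≤p+q : ∀ {p q} → 0ℚ ℚ.≤ q → p ℚ.≤ p ℚ.+ q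
p≤p+q {p} {q} 0≤q = subst (ℚ._≤ p ℚ.+ q) (ℚ.+-identityʳ p) (ℚ.+-monoʳ-≤ p 0≤q)

+-cancelʳ-≤ : ∀ r {p q} → p ℚ.+ r ℚ.≤ q ℚ.+ r → p ℚ.≤ q
+-cancelʳ-≤ r {p} {q} p+r≤q+r =
  subst₂ ℚ._≤_ (cancel p) (cancel q) (ℚ.+-monoˡ-≤ (ℚ.- r) p+r≤q+r)
  where
  cancel : ∀ s → (s ℚ.+ r) ℚ.- r ≡ s
  cancel s = solve 2 (λ s r → (s :+ r) :- r := s) refl s r

*-nonNeg : ∀ {p q} → 0ℚ ℚ.≤ p → 0ℚ ℚ.≤ q → 0ℚ ℚ.≤ p ℚ.* q
*-nonNeg {p} {q} 0≤p 0≤q = subst (ℚ._≤ p ℚ.* q) (ℚ.*-zeroʳ p)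
  (ℚ.*-monoˡ-≤-nonNeg p ⦃ ℚ.nonNegative 0≤p ⦄ 0≤q)

+-halves : ∀ p → ½ ℚ.* p ℚ.+ ½ ℚ.* p ≡ p
+-halves = solve 1 (λ p → con ½ :* p :+ con ½ :* p := p) refl

½*-pos : ∀ {p} → 0ℚ ℚ.< p → 0ℚ ℚ.< ½ ℚ.* p
½*-pos = ℚ.*-monoʳ-<-pos ½

0≤½ : 0ℚ ℚ.≤ ½
0≤½ = ℚ.nonNegative⁻¹ ½

0<2⁻ : ∀ n → 0ℚ ℚ.< 2⁻ n
0<2⁻ zero    = ℚ.positive⁻¹ 1ℚ
0<2⁻ (suc n) = ½*-pos (0<2⁻ n)

0≤2⁻ : ∀ n → 0ℚ ℚ.≤ 2⁻ n
0≤2⁻ n = ℚ.<⇒≤ (0<2⁻ n)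

private
  fromℕ : ℕ → ℚ
  fromℕ zero    = 0ℚ
  fromℕ (suc n) = 1ℚ ℚ.+ fromℕ n

  0≤fromℕ : ∀ n → 0ℚ ℚ.≤ fromℕ n
  0≤fromℕ zero    = ℚ.≤-refl
  0≤fromℕ (suc n) = ℚ.+-mono-≤ (ℚ.nonNegative⁻¹ 1ℚ) (0≤fromℕ n)

  toℚᵘ-fromℕ : ∀ n → ℚ.toℚᵘ (fromℕ n) ℚᵘ.≃ ℚᵘ.mkℚᵘ (ℤ.+ n) 0
  toℚᵘ-fromℕ zero    = ℚᵘ.≃-refl
  toℚᵘ-fromℕ (suc n) = ℚᵘ.≃-trans (ℚ.toℚᵘ-homo-+ 1ℚ (fromℕ n))
    (ℚᵘ.≃-trans (ℚᵘ.+-congʳ (ℚ.toℚᵘ 1ℚ) (toℚᵘ-fromℕ n))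
      (ℚᵘ.*≡* (cong (λ i → ((ℤ.+ 1) ℤ.+ i) ℤ.* (ℤ.+ 1)) (ℤ.*-identityʳ (ℤ.+ n)))))

  2⁻-*-fromℕ : ∀ n → 2⁻ n ℚ.* fromℕ (suc n) ℚ.≤ 1ℚ
  2⁻-*-fromℕ zero    = ℚ.≤-refl
  2⁻-*-fromℕ (suc n) = begin
    (½ ℚ.* p) ℚ.* (1ℚ ℚ.+ (1ℚ ℚ.+ x))                             ≤⟨ p≤p+q (*-nonNeg 0≤½ (*-nonNeg (0≤2⁻ n) (0≤fromℕ n))) ⟩
    (½ ℚ.* p) ℚ.* (1ℚ ℚ.+ (1ℚ ℚ.+ x)) ℚ.+ ½ ℚ.* (p ℚ.* x)         ≡⟨ solve 2 (λ p x → (con ½ :* p) :* (con 1ℚ :+ (con 1ℚ :+ x)) :+ con ½ :* (p :* x) := p :* (con 1ℚ :+ x)) refl p x ⟩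
    p ℚ.* (1ℚ ℚ.+ x)                                              ≤⟨ 2⁻-*-fromℕ n ⟩
    1ℚ                                                            ∎
    where
    open ℚ.≤-Reasoning
    p = 2⁻ n
    x = fromℕ n

-- A positive rational with denominator `suc d` is at least `1 / suc d`, and `suc d` is at most
-- `2^d`, so `d` itself serves as the exponent.
2⁻-archimedean : ∀ δ → 0ℚ ℚ.< δ → ∃[ m ] 2⁻ m ℚ.≤ δ
2⁻-archimedean δ@(mkℚ (ℤ.+ suc n) d _) 0<δ =
  d , ℚ.*-cancelʳ-≤-pos N ⦃ ℚ.positive 0<N ⦄ (ℚ.≤-trans (2⁻-*-fromℕ d) 1≤δN)
  where
  N = fromℕ (suc d)
  0<N : 0ℚ ℚ.< N
  0<N = ℚ.+-mono-<-≤ (ℚ.positive⁻¹ 1ℚ) (0≤fromℕ d)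
  1≤δN : 1ℚ ℚ.≤ δ ℚ.* N
  1≤δN = ℚ.toℚᵘ-cancel-≤ (ℚᵘ.≤-respʳ-≃
    (ℚᵘ.≃-sym (ℚᵘ.≃-trans (ℚ.toℚᵘ-homo-* δ N) (ℚᵘ.*-congˡ {ℚ.toℚᵘ δ} (toℚᵘ-fromℕ (suc d)))))
    (ℚᵘ.*≤* (ℤ.+≤+ (subst₂ _≤_ (sym (ℕ.+-identityʳ _)) (sym (ℕ.*-identityʳ _))
      (subst (_≤ suc n * suc d) (sym (ℕ.*-identityʳ (suc d))) (ℕ.m≤m+n (suc d) (n * suc d)))))))
2⁻-archimedean (mkℚ (ℤ.+ zero) d _)   (ℚ.*<* (ℤ.+<+ ()))
2⁻-archimedean (mkℚ (ℤ.-[1+ n ]) d _) (ℚ.*<* ())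

-- Finite sums of rationals

∑<-mono : ∀ {a b} k → (∀ i → i < k → a i ℚ.≤ b i) → ∑< k a ℚ.≤ ∑< k b
∑<-mono zero    a≤b = ℚ.≤-refl
∑<-mono (suc k) a≤b =
  ℚ.+-mono-≤ (∑<-mono k λ i i<k → a≤b i (ℕ.m<n⇒m<1+n i<k)) (a≤b k ℕ.≤-refl)

∑<-+ : ∀ {a b} k → ∑< k (λ i → a i ℚ.+ b i) ≡ ∑< k a ℚ.+ ∑< k b
∑<-+         zero    = refl
∑<-+ {a} {b} (suc k) = trans (cong (ℚ._+ (a k ℚ.+ b k)) (∑<-+ k))
  (solve 4 (λ s t x y → (s :+ t) :+ (x :+ y) := (s :+ x) :+ (t :+ y)) refl (∑< k a) (∑< k b) (a k) (b k))

∑<-cong : ∀ {a b} k → a ≗ b → ∑< k a ≡ ∑< k b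
∑<-cong zero    a≗b = refl
∑<-cong (suc k) a≗b = cong₂ ℚ._+_ (∑<-cong k a≗b) (a≗b k)

∑<-monoˡ : ∀ {a} → (∀ i → 0ℚ ℚ.≤ a i) → ∀ {k l} → k ℕ.≤′ l → ∑< k a ℚ.≤ ∑< l a
∑<-monoˡ 0≤a ℕ.≤′-refl                = ℚ.≤-refl
∑<-monoˡ 0≤a (ℕ.≤′-step {n = l} k≤l) = ℚ.≤-trans (∑<-monoˡ 0≤a k≤l) (p≤p+q (0≤a l))

∑<-nonNeg : ∀ {a} → (∀ i → 0ℚ ℚ.≤ a i) → ∀ k → 0ℚ ℚ.≤ ∑< k a
∑<-nonNeg 0≤a k = ∑<-monoˡ 0≤a (ℕ.≤⇒≤′ (z≤n {k}))

term≤∑< : ∀ {a} → (∀ i → 0ℚ ℚ.≤ a i) → ∀ i → a i ℚ.≤ ∑< (suc i) a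
term≤∑< {a} 0≤a i = subst (ℚ._≤ ∑< (suc i) a) (ℚ.+-identityˡ (a i)) (ℚ.+-monoˡ-≤ (a i) (∑<-nonNeg 0≤a i))

∑<-2⁻ : ∀ m k → ∑< k (λ i → 2⁻ (m + suc i)) ℚ.≤ 2⁻ m
∑<-2⁻ m k = subst (∑< k (λ i → 2⁻ (m + suc i)) ℚ.≤_) (telescope k) (p≤p+q (0≤2⁻ (m + k)))
  where
  telescope : ∀ k → ∑< k (λ i → 2⁻ (m + suc i)) ℚ.+ 2⁻ (m + k) ≡ 2⁻ m
  telescope zero    = trans (ℚ.+-identityˡ _) (cong 2⁻_ (ℕ.+-identityʳ m))
  telescope (suc k) rewrite ℕ.+-suc m k =
    trans (ℚ.+-assoc s (½ ℚ.* p) (½ ℚ.* p)) (trans (cong (s ℚ.+_) (+-halves p)) (telescope k))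
    where
    s = ∑< k (λ i → 2⁻ (m + suc i))
    p = 2⁻ (m + k)

-- Binary successor with carry. A string of ones overflows to the zeros of the next length, as the
-- length-lexicographic order demands.
increment : String → String
increment ε           = ε ▹ false
increment (σ ▹ false) = σ ▹ true
increment (σ ▹ true)  = increment σ ▹ false

decode : ℕ → String
decode zero    = ε
decode (suc n) = increment (decode n)

code-increment : ∀ σ → code (increment σ) ≡ suc (code σ)
code-increment ε           = refl
code-increment (σ ▹ false) = refl
code-increment (σ ▹ true)  rewrite code-increment σ = cong suc (ℕ.*-suc 2 (code σ))

code-decode : ∀ n → code (decode n) ≡ n
code-decode zero    = refl
code-decode (suc n) = trans (code-increment (decode n)) (cong suc (code-decode n))

decode-▹false : ∀ n → decode (1 + 2 * n) ≡ decode n ▹ false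
decode-▹false zero    = refl
decode-▹false (suc n) = trans (cong (λ k → decode (suc k)) (ℕ.*-suc 2 n))
  (cong (λ σ → increment (increment σ)) (decode-▹false n))

decode-▹true : ∀ n → decode (2 + 2 * n) ≡ decode n ▹ true
decode-▹true n = cong increment (decode-▹false n)

decode-code : ∀ σ → decode (code σ) ≡ σ
decode-code ε           = refl
decode-code (σ ▹ false) = trans (decode-▹false (code σ)) (cong (_▹ false) (decode-code σ))
decode-code (σ ▹ true)  = trans (decode-▹true (code σ)) (cong (_▹ true) (decode-code σ))

code-injective : ∀ {σ τ} → code σ ≡ code τ → σ ≡ τ
code-injective {σ} {τ} eq = trans (sym (decode-code σ)) (trans (cong decode eq) (decode-code τ))

-- In the length-lexicographic order the children of the k-th string are the
-- strings 2k + 1 and 2k + 2, so the leaves of the tree formed by the first k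
-- strings are those from k to 2k, and their total potential is the second sum
-- of the invariant minus the last one.
∑<-tree : (a F : String → ℚ) → (∀ σ → 0ℚ ℚ.≤ F σ) →
  (∀ σ → a σ ℚ.+ (F (σ ▹ false) ℚ.+ F (σ ▹ true)) ℚ.≤ F σ) →
  ∀ k → ∑< k (λ i → a (decode i)) ℚ.≤ F ε
∑<-tree a F 0≤F superfair k = +-cancelʳ-≤ (∑< k f) (ℚ.≤-trans
  (ℚ.+-monoʳ-≤ (∑< k _) (∑<-monoˡ (λ i → 0≤F (decode i))
    (ℕ.≤⇒≤′ (ℕ.m≤n⇒m≤1+n (ℕ.m≤m+n k (k + 0))))))
  (invariant k))
  where
  f : ℕ → ℚ
  f i = F (decode i)
  invariant : ∀ k → ∑< k (λ i → a (decode i)) ℚ.+ ∑< (suc (2 * k)) f ℚ.≤ F ε ℚ.+ ∑< k f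
  invariant zero    = ℚ.≤-reflexive (solve 1 (λ p → con 0ℚ :+ (con 0ℚ :+ p) := p :+ con 0ℚ) refl (F ε))
  invariant (suc k) = begin
    (A ℚ.+ x) ℚ.+ ∑< (suc (2 * suc k)) f ≡⟨ cong (λ n → (A ℚ.+ x) ℚ.+ ∑< (suc n) f) (ℕ.*-suc 2 k) ⟩
    (A ℚ.+ x) ℚ.+ ((S ℚ.+ f (1 + 2 * k)) ℚ.+ f (2 + 2 * k)) ≡⟨ cong₂ (λ σ τ → (A ℚ.+ x) ℚ.+ ((S ℚ.+ F σ) ℚ.+ F τ)) (decode-▹false k) (decode-▹true k) ⟩
    (A ℚ.+ x) ℚ.+ ((S ℚ.+ y) ℚ.+ z) ≡⟨ solve 5 (λ A x S y z → (A :+ x) :+ ((S :+ y) :+ z) := (A :+ S) :+ (x :+ (y :+ z))) refl A x S y z ⟩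
    (A ℚ.+ S) ℚ.+ (x ℚ.+ (y ℚ.+ z)) ≤⟨ ℚ.+-mono-≤ (invariant k) (superfair (decode k)) ⟩
    (F ε ℚ.+ ∑< k f) ℚ.+ f k        ≡⟨ ℚ.+-assoc (F ε) (∑< k f) (f k) ⟩
    F ε ℚ.+ (∑< k f ℚ.+ f k)        ∎
    where
    open ℚ.≤-Reasoning
    A = ∑< k (λ i → a (decode i))
    S = ∑< (suc (2 * k)) f
    x = a (decode k)
    y = F (decode k ▹ false)
    z = F (decode k ▹ true)

∣↾∣ : ∀ X n → ∣ X ↾ n ∣ ≡ n
∣↾∣ X zero    = refl
∣↾∣ X (suc n) = cong suc (∣↾∣ X n)

↾-≺ : ∀ X n → X ↾ n ≺ X
↾-≺ X n = cong (X ↾_) (∣↾∣ X n)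

▹-injective : ∀ {σ τ b c} → σ ▹ b ≡ τ ▹ c → σ ≡ τ × b ≡ c
▹-injective refl = refl , refl

≺-parent : ∀ {σ b X} → σ ▹ b ≺ X → σ ≺ X × X ∣ σ ∣ ≡ b
≺-parent = ▹-injective

-- Lebesgue outer measure

weight : Maybe String → ℚ
weight nothing  = 0ℚ
weight (just σ) = 2⁻ ∣ σ ∣

PartialCover : Pred Cantor 0ℓ → ℚ → Set
PartialCover S q = Σ[ C ∈ (ℕ → Maybe String) ]
  (∀ X → X ∈ S → ∃[ i ] ∃[ σ ] C i ≡ just σ × X ∈ ⟦ σ ⟧) ×
  (∀ k → ∑< k (λ i → weight (C i)) ℚ.≤ q)

zeros : ℕ → String
zeros zero    = ε
zeros (suc n) = zeros n ▹ false

∣zeros∣ : ∀ n → ∣ zeros n ∣ ≡ n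
∣zeros∣ zero    = refl
∣zeros∣ (suc n) = cong suc (∣zeros∣ n)

-- The gaps of a partial cover are filled with cylinders of total weight at most δ / 2.
partialCovers⇒lebesgue : ∀ {S q} → (∀ δ → 0ℚ ℚ.< δ → PartialCover S (q ℚ.+ δ)) → lebesgue S q
partialCovers⇒lebesgue {S} {q} cover δ 0<δ
  with cover (½ ℚ.* δ) (½*-pos 0<δ) | 2⁻-archimedean (½ ℚ.* δ) (½*-pos 0<δ)
... | C , covers , bound | m , 2⁻m≤δ/2 = (λ i → fill i (C i)) , covers′ , bound′
  where
  fill : ℕ → Maybe String → String
  fill i (just σ) = σ
  fill i nothing  = zeros (m + suc i)

  covers′ : ∀ X → X ∈ S → ∃[ i ] X ∈ ⟦ fill i (C i) ⟧
  covers′ X X∈S with covers X X∈S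
  ... | i , σ , eq , σ≺X = i , subst (λ D → X ∈ ⟦ fill i D ⟧) (sym eq) σ≺X

  fill-weight : ∀ i D → 2⁻ ∣ fill i D ∣ ℚ.≤ weight D ℚ.+ 2⁻ (m + suc i)
  fill-weight i (just σ) = p≤p+q (0≤2⁻ (m + suc i))
  fill-weight i nothing  = ℚ.≤-reflexive
    (trans (cong 2⁻_ (∣zeros∣ (m + suc i))) (sym (ℚ.+-identityˡ _)))

  bound′ : ∀ k → ∑< k (λ i → 2⁻ ∣ fill i (C i) ∣) ℚ.≤ q ℚ.+ δ
  bound′ k = begin
    ∑< k (λ i → 2⁻ ∣ fill i (C i) ∣)                              ≤⟨ ∑<-mono k (λ i _ → fill-weight i (C i)) ⟩
    ∑< k (λ i → weight (C i) ℚ.+ 2⁻ (m + suc i))                  ≡⟨ ∑<-+ k ⟩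
    ∑< k (λ i → weight (C i)) ℚ.+ ∑< k (λ i → 2⁻ (m + suc i))     ≤⟨ ℚ.+-mono-≤ (bound k) (ℚ.≤-trans (∑<-2⁻ m k) 2⁻m≤δ/2) ⟩
    (q ℚ.+ ½ ℚ.* δ) ℚ.+ ½ ℚ.* δ                                   ≡⟨ solve 2 (λ q δ → (q :+ con ½ :* δ) :+ con ½ :* δ := q :+ δ) refl q δ ⟩
    q ℚ.+ δ                                                       ∎
    where open ℚ.≤-Reasoning

-- The potential `F σ` is a budget for all cylinders placed at `σ` or below it. The budget is
-- checked locally, at each node, and `F ε` then bounds every partial sum.
treeCover⇒partialCover : ∀ {S : Pred Cantor 0ℓ} {q} (D : String → Maybe String) (F : String → ℚ) →
  (∀ X → X ∈ S → ∃[ ρ ] ∃[ σ ] D ρ ≡ just σ × X ∈ ⟦ σ ⟧) →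
  (∀ σ → 0ℚ ℚ.≤ F σ) →
  (∀ σ → weight (D σ) ℚ.+ (F (σ ▹ false) ℚ.+ F (σ ▹ true)) ℚ.≤ F σ) →
  F ε ℚ.≤ q → PartialCover S q
treeCover⇒partialCover D F covers 0≤F superfair Fε≤q = (λ i → D (decode i)) ,
  (λ X X∈S → let ρ , σ , eq , σ≺X = covers X X∈S in
    code ρ , σ , trans (cong D (decode-code ρ)) eq , σ≺X) ,
  (λ k → ℚ.≤-trans (∑<-tree (λ σ → weight (D σ)) F 0≤F superfair k) Fε≤q)

lebesgue-mono : ∀ {S S′} q → S ⊆ S′ → lebesgue S′ q → lebesgue S q
lebesgue-mono q S⊆S′ μ δ 0<δ with μ δ 0<δ
... | C , covers , bound = C , (λ X X∈S → covers X (S⊆S′ X∈S)) , bound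

lebesgue-∅ : ∀ {S} → (∀ X → X ∉ S) → ∀ n → lebesgue S (2⁻ n)
lebesgue-∅ ∄S n = partialCovers⇒lebesgue {q = 2⁻ n} λ δ 0<δ → (λ _ → nothing) ,
  (λ X X∈S → contradiction X∈S (∄S X)) ,
  (λ k → ℚ.≤-trans (∑<-mono {b = λ i → 2⁻ (n + suc i)} k λ i _ → 0≤2⁻ (n + suc i))
    (ℚ.≤-trans (∑<-2⁻ n k) (p≤p+q (ℚ.<⇒≤ 0<δ))))

lebesgue-inf : ∀ {S q} → (∀ δ → 0ℚ ℚ.< δ → lebesgue S (q ℚ.+ δ)) → lebesgue S q
lebesgue-inf {S} {q} μ δ 0<δ with μ (½ ℚ.* δ) (½*-pos 0<δ) (½ ℚ.* δ) (½*-pos 0<δ)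
... | C , covers , bound = C , covers , λ k → subst (∑< k (λ i → 2⁻ ∣ C i ∣) ℚ.≤_)
  (solve 2 (λ q δ → (q :+ con ½ :* δ) :+ con ½ :* δ := q :+ δ) refl q δ) (bound k)

-- The l-th cylinder of the cover of the i-th set is placed at the node
-- 1ⁱ0ˡ⁺¹ of the binary tree.
private
  data Place : Set where
    spine : ℕ → Place
    row   : ℕ → ℕ → Place
    off   : Place

  child : Place → Bool → Place
  child (spine i) true  = spine (suc i)
  child (spine i) false = row i 0
  child (row i l) false = row i (suc l)
  child (row i l) true  = off
  child off       _     = off

  place : String → Place
  place ε       = spine 0
  place (σ ▹ b) = child (place σ) b

  ones : ℕ → String
  ones zero    = ε
  ones (suc i) = ones i ▹ true

  place-ones : ∀ i → place (ones i) ≡ spine i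
  place-ones zero    = refl
  place-ones (suc i) = cong (λ p → child p true) (place-ones i)

  node : ℕ → ℕ → String
  node i zero    = ones i ▹ false
  node i (suc l) = node i l ▹ false

  place-node : ∀ i l → place (node i l) ≡ row i l
  place-node i zero    = cong (λ p → child p false) (place-ones i)
  place-node i (suc l) = cong (λ p → child p false) (place-node i l)

-- The cover of the `i`-th set is taken with slack `2⁻ (m + suc i)`; these slacks add up to at most
-- `2⁻ m`, hence to at most `δ`.
lebesgue-⋃ : ∀ (S : ℕ → Pred Cantor 0ℓ) (q : ℕ → ℚ) {Q} → (∀ i → lebesgue (S i) (q i)) →
  (∀ k → ∑< k q ℚ.≤ Q) → lebesgue (λ X → ∃[ i ] X ∈ S i) Q
lebesgue-⋃ S q {Q} μ ∑q≤Q = partialCovers⇒lebesgue {q = Q} cover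
  where
  cover : ∀ δ → 0ℚ ℚ.< δ → PartialCover (λ X → ∃[ i ] X ∈ S i) (Q ℚ.+ δ)
  cover δ 0<δ with 2⁻-archimedean δ 0<δ
  ... | m , 2⁻m≤δ = treeCover⇒partialCover (λ σ → at-place (place σ)) (λ σ → F (place σ))
    covers (λ σ → 0≤F (place σ)) (λ σ → ℚ.≤-reflexive (fair (place σ)))
    (ℚ.≤-reflexive (solve 1 (λ p → p :- con 0ℚ := p) refl (Q ℚ.+ δ)))
    where
    coverᵢ : ∀ i → Σ[ C ∈ (ℕ → String) ] (∀ X → X ∈ S i → ∃[ l ] X ∈ ⟦ C l ⟧) ×
      (∀ k → ∑< k (λ l → 2⁻ ∣ C l ∣) ℚ.≤ q i ℚ.+ 2⁻ (m + suc i))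
    coverᵢ i = μ i (2⁻ (m + suc i)) (0<2⁻ (m + suc i))

    C : ℕ → ℕ → String
    C i = proj₁ (coverᵢ i)

    at-place : Place → Maybe String
    at-place (row i l) = just (C i l)
    at-place _         = nothing

    total : ℕ → ℚ
    total i = q i ℚ.+ 2⁻ (m + suc i)

    -- The budget still unspent: on the spine for the sets from the `i`-th on, in a row for the
    -- cylinders from the `l`-th on.
    F : Place → ℚ
    F (spine i) = (Q ℚ.+ δ) ℚ.- ∑< i total
    F (row i l) = total i ℚ.- ∑< l (λ j → 2⁻ ∣ C i j ∣)
    F off       = 0ℚ

    covers : ∀ X → ∃[ i ] X ∈ S i → ∃[ ρ ] ∃[ σ ] at-place (place ρ) ≡ just σ × X ∈ ⟦ σ ⟧
    covers X (i , X∈Sᵢ) with proj₁ (proj₂ (coverᵢ i)) X X∈Sᵢ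
    ... | l , X∈Cᵢₗ = node i l , C i l , cong at-place (place-node i l) , X∈Cᵢₗ

    0≤F : ∀ p → 0ℚ ℚ.≤ F p
    0≤F (spine i) = p≤q⇒0≤q-p (ℚ.≤-trans (ℚ.≤-reflexive (∑<-+ i))
      (ℚ.+-mono-≤ (∑q≤Q i) (ℚ.≤-trans (∑<-2⁻ m i) 2⁻m≤δ)))
    0≤F (row i l) = p≤q⇒0≤q-p (proj₂ (proj₂ (coverᵢ i)) l)
    0≤F off       = ℚ.≤-refl

    fair : ∀ p → weight (at-place p) ℚ.+ (F (child p false) ℚ.+ F (child p true)) ≡ F p
    fair (spine i) = solve 3 (λ Q s t → con 0ℚ :+ ((t :- con 0ℚ) :+ (Q :- (s :+ t))) := Q :- s) refl
      (Q ℚ.+ δ) (∑< i total) (total i)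
    fair (row i l) = solve 3 (λ t s x → x :+ ((t :- (s :+ x)) :+ con 0ℚ) := t :- s) refl
      (total i) (∑< l (λ j → 2⁻ ∣ C i j ∣)) (2⁻ ∣ C i l ∣)
    fair off       = refl

-- The martingale condition for a fair coin, doubled to avoid division.
Fair : (String → ℚ) → Set
Fair v = ∀ σ → v (σ ▹ false) ℚ.+ v (σ ▹ true) ≡ v σ ℚ.+ v σ

-- Kolmogorov's inequality for the martingale v.
lebesgue-hit : ∀ v → (∀ σ → 0ℚ ℚ.≤ v σ) → Fair v →
  lebesgue (λ Y → ∃[ n ] 1ℚ ℚ.≤ v (Y ↾ n)) (v ε)
lebesgue-hit v 0≤v fair = partialCovers⇒lebesgue {q = v ε} λ δ 0<δ →
  treeCover⇒partialCover D F covers 0≤F superfair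
    (ℚ.≤-trans (ℚ.≤-reflexive (ℚ.*-identityˡ (v ε))) (p≤p+q (ℚ.<⇒≤ 0<δ)))
  where
  hit : String → Bool
  hit σ = 1ℚ ℚ.≤ᵇ v σ

  clear : String → Bool
  clear ε       = true
  clear (σ ▹ _) = clear σ ∧ not (hit σ)

  -- Only the minimal strings on which `v` reaches 1 enter the cover.
  D : String → Maybe String
  D σ = if clear σ ∧ hit σ then just σ else nothing

  -- Below a minimal hit `σ` the potential drops to 0. This frees `2⁻ ∣ σ ∣ ℚ.* v σ`, which pays for
  -- the cylinder because `v σ` is at least 1.
  F : String → ℚ
  F σ = if clear σ then 2⁻ ∣ σ ∣ ℚ.* v σ else 0ℚ

  0≤F : ∀ σ → 0ℚ ℚ.≤ F σ
  0≤F σ with clear σ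
  ... | true  = *-nonNeg (0≤2⁻ ∣ σ ∣) (0≤v σ)
  ... | false = ℚ.≤-refl

  superfair : ∀ σ → weight (D σ) ℚ.+ (F (σ ▹ false) ℚ.+ F (σ ▹ true)) ℚ.≤ F σ
  superfair σ with clear σ | hit σ in hit-σ
  ... | false | _     = ℚ.≤-refl
  ... | true  | true  = begin
    p ℚ.+ (0ℚ ℚ.+ 0ℚ)   ≡⟨ solve 1 (λ p → p :+ (con 0ℚ :+ con 0ℚ) := p :* con 1ℚ) refl p ⟩
    p ℚ.* 1ℚ            ≤⟨ ℚ.*-monoˡ-≤-nonNeg p ⦃ ℚ.nonNegative (0≤2⁻ ∣ σ ∣) ⦄ (ℚ.≤ᵇ⇒≤ (Equivalence.from Bool.T-≡ hit-σ)) ⟩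
    p ℚ.* v σ           ∎
    where
    open ℚ.≤-Reasoning
    p = 2⁻ ∣ σ ∣
  ... | true  | false = ℚ.≤-reflexive (begin
    0ℚ ℚ.+ ((½ ℚ.* p) ℚ.* x ℚ.+ (½ ℚ.* p) ℚ.* y)  ≡⟨ solve 3 (λ p x y → con 0ℚ :+ ((con ½ :* p) :* x :+ (con ½ :* p) :* y) := (con ½ :* p) :* (x :+ y)) refl p x y ⟩
    (½ ℚ.* p) ℚ.* (x ℚ.+ y)                       ≡⟨ cong ((½ ℚ.* p) ℚ.*_) (fair σ) ⟩
    (½ ℚ.* p) ℚ.* (v σ ℚ.+ v σ)                   ≡⟨ solve 2 (λ p x → (con ½ :* p) :* (x :+ x) := p :* x) refl p (v σ) ⟩
    p ℚ.* v σ                                     ∎)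
    where
    open ≡-Reasoning
    p = 2⁻ ∣ σ ∣
    x = v (σ ▹ false)
    y = v (σ ▹ true)

  first-hit : ∀ Y n → clear (Y ↾ n) ≡ true ⊎ ∃[ m ] D (Y ↾ m) ≡ just (Y ↾ m)
  first-hit Y zero    = inj₁ refl
  first-hit Y (suc n) with first-hit Y n
  ... | inj₂ found = inj₂ found
  ... | inj₁ clear-n with hit (Y ↾ n) in hit-n
  ...   | false = inj₁ (cong (_∧ true) clear-n)
  ...   | true  = inj₂ (n , cong₂ (λ c h → if c ∧ h then just (Y ↾ n) else nothing) clear-n hit-n)

  covers : ∀ Y → ∃[ n ] 1ℚ ℚ.≤ v (Y ↾ n) → ∃[ ρ ] ∃[ σ ] D ρ ≡ just σ × Y ∈ ⟦ σ ⟧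
  covers Y (n , 1≤v) with first-hit Y n
  ... | inj₂ (m , eq) = Y ↾ m , Y ↾ m , eq , ↾-≺ Y m
  ... | inj₁ clear-n  = Y ↾ n , Y ↾ n ,
    cong₂ (λ c h → if c ∧ h then just (Y ↾ n) else nothing) clear-n
      (Equivalence.to Bool.T-≡ (ℚ.≤⇒≤ᵇ 1≤v)) , ↾-≺ Y n

-- Selected subsequences and martingales

at : String → ℕ → Maybe Bool
at ε       k = nothing
at (σ ▹ b) k = if does (k ℕ.≟ ∣ σ ∣) then just b else at σ k

at-last : ∀ σ b → at (σ ▹ b) ∣ σ ∣ ≡ just b
at-last σ b = cong (λ d → if d then just b else at σ ∣ σ ∣) (dec-true (∣ σ ∣ ℕ.≟ ∣ σ ∣) refl)

at-▹ : ∀ σ b {k} → k ≢ ∣ σ ∣ → at (σ ▹ b) k ≡ at σ k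
at-▹ σ b {k} k≢ = cong (λ d → if d then just b else at σ k) (dec-false (k ℕ.≟ ∣ σ ∣) k≢)

at-≥ : ∀ σ {k} → ∣ σ ∣ ≤ k → at σ k ≡ nothing
at-≥ ε       _     = refl
at-≥ (σ ▹ b) ∣σ∣<k = trans (at-▹ σ b (ℕ.>⇒≢ ∣σ∣<k)) (at-≥ σ (ℕ.<⇒≤ ∣σ∣<k))

at-< : ∀ σ {k} → k < ∣ σ ∣ → ∃[ b ] at σ k ≡ just b
at-< (σ ▹ b) {k} k≤∣σ∣ with k ℕ.≟ ∣ σ ∣
... | yes refl = b , at-last σ b
... | no  k≢   = let c , eq = at-< σ (ℕ.≤∧≢⇒< (ℕ.≤-pred k≤∣σ∣) k≢) in
  c , trans (at-▹ σ b k≢) eq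

at⇒< : ∀ σ {k b} → at σ k ≡ just b → k < ∣ σ ∣
at⇒< σ {k} eq with ∣ σ ∣ ℕ.≤? k
... | no  ≰  = ℕ.≰⇒> ≰
... | yes ≤k with () ← trans (sym eq) (at-≥ σ ≤k)

at-mono : ∀ σ c {k b} → at σ k ≡ just b → at (σ ▹ c) k ≡ just b
at-mono σ c eq = trans (at-▹ σ c (ℕ.<⇒≢ (at⇒< σ eq))) eq

at-↾ : ∀ X {k n} → k < n → at (X ↾ n) k ≡ just (X k)
at-↾ X {k} {suc n} k<1+n with k ℕ.≟ ∣ X ↾ n ∣
... | yes refl = trans (at-last (X ↾ n) (X n)) (cong (λ j → just (X j)) (sym (∣↾∣ X n)))
... | no  k≢   = trans (at-▹ (X ↾ n) (X n) k≢) (at-↾ X (ℕ.≤∧≢⇒< (ℕ.≤-pred k<1+n) λ k≡n → k≢ (trans k≡n (sym (∣↾∣ X n)))))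

at⇒≺ : ∀ σ X → (∀ k b → at σ k ≡ just b → X k ≡ b) → σ ≺ X
at⇒≺ ε       X agree = refl
at⇒≺ (σ ▹ c) X agree = cong₂ _▹_
  (at⇒≺ σ X (λ k b eq → agree k b (at-mono σ c eq))) (agree ∣ σ ∣ c (at-last σ c))

-- A stage may repeat the previous one, since a selection adds nothing at a position that is not
-- selected.
Chain : (ℕ → String) → Set
Chain s = ∀ m → s (suc m) ≡ s m ⊎ ∃[ b ] s (suc m) ≡ s m ▹ b

module _ {s : ℕ → String} (chain : Chain s) where

  chain-at : ∀ {m n} → m ℕ.≤′ n → ∀ {k b} → at (s m) k ≡ just b → at (s n) k ≡ just b
  chain-at ℕ.≤′-refl               eq = eq
  chain-at (ℕ.≤′-step {n = n} m≤n) eq with chain n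
  ... | inj₁ same       = trans (cong (λ σ → at σ _) same) (chain-at m≤n eq)
  ... | inj₂ (c , more) = trans (cong (λ σ → at σ _) more) (at-mono (s n) c (chain-at m≤n eq))

  chain-limit : (∀ k → ∃[ m ] k < ∣ s m ∣) → ∃[ X ] ∀ m → s m ≺ X
  chain-limit unbounded = X , λ m → at⇒≺ (s m) X (agree m)
    where
    bit : ∀ k → ∃[ b ] at (s (proj₁ (unbounded k))) k ≡ just b
    bit k = at-< (s (proj₁ (unbounded k))) (proj₂ (unbounded k))

    X : Cantor
    X k = proj₁ (bit k)

    agree : ∀ m k b → at (s m) k ≡ just b → X k ≡ b
    agree m k b eq with ℕ.≤-total m (proj₁ (unbounded k))
    ... | inj₁ m≤ = just-injective (trans (sym (proj₂ (bit k))) (chain-at (ℕ.≤⇒≤′ m≤) eq))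
    ... | inj₂ ≤m = just-injective (trans (sym (chain-at (ℕ.≤⇒≤′ ≤m) (proj₂ (bit k)))) eq)

  -- The length grows by at most one at each stage, so no length is skipped.
  chain-lengths : ∣ s 0 ∣ ≡ 0 → ∀ n {k} → k ≤ ∣ s n ∣ → ∃[ m ] ∣ s m ∣ ≡ k
  chain-lengths start zero    k≤0 = 0 , ℕ.≤-antisym (subst (_≤ _) (sym start) z≤n) k≤0
  chain-lengths start (suc n) {k} k≤ with k ℕ.≤? ∣ s n ∣
  ... | yes k≤∣sₙ∣ = chain-lengths start n k≤∣sₙ∣
  ... | no  k≰∣sₙ∣ with chain n
  ...   | inj₁ same       = contradiction (subst (λ σ → k ≤ ∣ σ ∣) same k≤) k≰∣sₙ∣
  ...   | inj₂ (b , more) = suc n , ℕ.≤-antisym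
    (subst (λ σ → ∣ σ ∣ ≤ k) (sym more) (ℕ.≰⇒> k≰∣sₙ∣)) k≤

≺-∣∣-injective : ∀ {σ τ X} → σ ≺ X → τ ≺ X → ∣ σ ∣ ≡ ∣ τ ∣ → σ ≡ τ
≺-∣∣-injective {X = X} σ≺X τ≺X eq = trans (sym σ≺X) (trans (cong (X ↾_) eq) τ≺X)

-- The subsequence of the bits of a string that are preceded by a prefix
-- satisfying sel.
select : (String → Bool) → String → String
select sel ε       = ε
select sel (τ ▹ b) = if sel τ then select sel τ ▹ b else select sel τ

module _ (sel : String → Bool) where

  select-true : ∀ τ b → sel τ ≡ true → select sel (τ ▹ b) ≡ select sel τ ▹ b
  select-true τ b eq = cong (λ d → if d then select sel τ ▹ b else select sel τ) eq

  select-false : ∀ τ b → sel τ ≡ false → select sel (τ ▹ b) ≡ select sel τ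
  select-false τ b eq = cong (λ d → if d then select sel τ ▹ b else select sel τ) eq

  select-chain : ∀ Y → Chain (λ m → select sel (Y ↾ m))
  select-chain Y m with sel (Y ↾ m)
  ... | true  = inj₂ (Y m , refl)
  ... | false = inj₁ refl

  Infinite : Cantor → Set
  Infinite Y = ∀ m → ∃[ n ] m ≤ n × sel (Y ↾ n) ≡ true

  ∣select∣-mono : ∀ Y {m n} → m ℕ.≤′ n → ∣ select sel (Y ↾ m) ∣ ≤ ∣ select sel (Y ↾ n) ∣
  ∣select∣-mono Y ℕ.≤′-refl = ℕ.≤-refl
  ∣select∣-mono Y (ℕ.≤′-step {n = n} m≤n) with sel (Y ↾ n)
  ... | true  = ℕ.m≤n⇒m≤1+n (∣select∣-mono Y m≤n)
  ... | false = ∣select∣-mono Y m≤n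

  select-unbounded : ∀ Y → Infinite Y → ∀ k → ∃[ m ] k < ∣ select sel (Y ↾ m) ∣
  select-unbounded Y inf k = let m , k≤ = reach k ; n , m≤n , sel-n = inf m in
    suc n , ℕ.≤-trans (s≤s (ℕ.≤-trans k≤ (∣select∣-mono Y (ℕ.≤⇒≤′ m≤n))))
      (ℕ.≤-reflexive (cong (λ b → ∣ if b then select sel (Y ↾ n) ▹ Y n else select sel (Y ↾ n) ∣) (sym sel-n)))
    where
    reach : ∀ k → ∃[ m ] k ≤ ∣ select sel (Y ↾ m) ∣
    reach zero    = 0 , z≤n
    reach (suc k) = select-unbounded Y inf k

  -- Some stage has the length of `C`, and two prefixes of `R` of equal length coincide.
  select-reaches : ∀ Y {R} → Infinite Y → (∀ m → select sel (Y ↾ m) ≺ R) →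
    ∀ C → C ≺ R → ∃[ m ] select sel (Y ↾ m) ≡ C
  select-reaches Y inf all≺R C C≺R =
    let n , ∣C∣<  = select-unbounded Y inf ∣ C ∣
        m , ∣sₘ∣≡ = chain-lengths (select-chain Y) refl n (ℕ.<⇒≤ ∣C∣<)
    in m , ≺-∣∣-injective (all≺R m) C≺R ∣sₘ∣≡

  -- If each bit of C at a selected position, and each bit at a position
  -- beyond the end of τ, is chosen by a fair coin, and the others are copied
  -- from τ, then W C τ is the probability that C is produced.
  factor : Bool → Maybe Bool → Bool → ℚ
  factor true  _        _ = ½
  factor false nothing  _ = ½
  factor false (just b) c = if does (b Bool.≟ c) then 1ℚ else 0ℚ

  W : String → String → ℚ
  W ε       τ = 1ℚ
  W (C ▹ b) τ = W C τ ℚ.* factor (sel C) (at τ ∣ C ∣) b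

  0≤W : ∀ C τ → 0ℚ ℚ.≤ W C τ
  0≤W ε       τ = ℚ.nonNegative⁻¹ 1ℚ
  0≤W (C ▹ b) τ = *-nonNeg (0≤W C τ) (0≤factor (sel C) (at τ ∣ C ∣))
    where
    0≤factor : ∀ s c → 0ℚ ℚ.≤ factor s c b
    0≤factor true  _        = 0≤½
    0≤factor false nothing  = 0≤½
    0≤factor false (just c) with does (c Bool.≟ b)
    ... | true  = ℚ.nonNegative⁻¹ 1ℚ
    ... | false = ℚ.≤-refl

  factor-nothing : ∀ s b → factor s nothing b ≡ ½
  factor-nothing true  b = refl
  factor-nothing false b = refl

  W-ε : ∀ C → W C ε ≡ 2⁻ ∣ C ∣
  W-ε ε       = refl
  W-ε (C ▹ b) = trans (cong₂ ℚ._*_ (W-ε C) (factor-nothing (sel C) b)) (ℚ.*-comm (2⁻ ∣ C ∣) ½)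

  W-local : ∀ C {τ} b → ∣ C ∣ ≤ ∣ τ ∣ → W C (τ ▹ b) ≡ W C τ
  W-local ε           b _    = refl
  W-local (C ▹ c) {τ} b ∣C∣< = cong₂ (λ p o → p ℚ.* factor (sel C) o c)
    (W-local C b (ℕ.<⇒≤ ∣C∣<)) (at-▹ τ b (ℕ.<⇒≢ ∣C∣<))

  factor-fair : ∀ s c → factor s (just false) c ℚ.+ factor s (just true) c ≡ ½ ℚ.+ ½
  factor-fair true  c     = refl
  factor-fair false false = refl
  factor-fair false true  = refl

  -- A new bit of `τ` affects the last factor only if it lands on position `∣ C ∣`. There the factor
  -- was ½, its average over the new bit is again ½, and the earlier factors do not change.
  -- Otherwise the last factor is constant and the induction hypothesis applies.
  W-fair : ∀ C → Fair (W C)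
  W-fair ε       τ = refl
  W-fair (C ▹ c) τ with ∣ C ∣ ℕ.≟ ∣ τ ∣
  ... | yes eq = begin
    W C (τ ▹ false) ℚ.* f (at (τ ▹ false) ∣ C ∣) ℚ.+ W C (τ ▹ true) ℚ.* f (at (τ ▹ true) ∣ C ∣)
      ≡⟨ cong₂ ℚ._+_ (bit false) (bit true) ⟩
    w ℚ.* f (just false) ℚ.+ w ℚ.* f (just true)
      ≡⟨ ℚ.*-distribˡ-+ w (f (just false)) (f (just true)) ⟨
    w ℚ.* (f (just false) ℚ.+ f (just true))
      ≡⟨ cong (w ℚ.*_) (factor-fair (sel C) c) ⟩
    w ℚ.* (½ ℚ.+ ½)
      ≡⟨ ℚ.*-distribˡ-+ w ½ ½ ⟩
    w ℚ.* ½ ℚ.+ w ℚ.* ½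
      ≡⟨ cong (λ p → w ℚ.* p ℚ.+ w ℚ.* p) half ⟨
    w ℚ.* f (at τ ∣ C ∣) ℚ.+ w ℚ.* f (at τ ∣ C ∣) ∎
    where
    open ≡-Reasoning
    w = W C τ
    f : Maybe Bool → ℚ
    f o = factor (sel C) o c
    bit : ∀ b → W C (τ ▹ b) ℚ.* f (at (τ ▹ b) ∣ C ∣) ≡ w ℚ.* f (just b)
    bit b = cong₂ (λ p o → p ℚ.* f o) (W-local C b (ℕ.≤-reflexive eq))
      (trans (cong (at (τ ▹ b)) eq) (at-last τ b))
    half : f (at τ ∣ C ∣) ≡ ½
    half = trans (cong f (at-≥ τ (ℕ.≤-reflexive (sym eq)))) (factor-nothing (sel C) c)
  ... | no ∣C∣≢ = begin
    W C (τ ▹ false) ℚ.* f (at (τ ▹ false) ∣ C ∣) ℚ.+ W C (τ ▹ true) ℚ.* f (at (τ ▹ true) ∣ C ∣)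
      ≡⟨ cong₂ (λ o o′ → W C (τ ▹ false) ℚ.* f o ℚ.+ W C (τ ▹ true) ℚ.* f o′) (at-▹ τ false ∣C∣≢) (at-▹ τ true ∣C∣≢) ⟩
    W C (τ ▹ false) ℚ.* x ℚ.+ W C (τ ▹ true) ℚ.* x
      ≡⟨ ℚ.*-distribʳ-+ x (W C (τ ▹ false)) (W C (τ ▹ true)) ⟨
    (W C (τ ▹ false) ℚ.+ W C (τ ▹ true)) ℚ.* x
      ≡⟨ cong (ℚ._* x) (W-fair C τ) ⟩
    (W C τ ℚ.+ W C τ) ℚ.* x
      ≡⟨ ℚ.*-distribʳ-+ x (W C τ) (W C τ) ⟩
    W C τ ℚ.* x ℚ.+ W C τ ℚ.* x ∎
    where
    open ≡-Reasoning
    f : Maybe Bool → ℚ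
    f o = factor (sel C) o c
    x = f (at τ ∣ C ∣)

-- The bits are chosen greedily: if the bound failed for both extensions of a
-- string, then, the sum being monotone in k, it would fail for the string.
module _ (em : ExcludedMiddle 0ℓ) (w : ℕ → String → ℚ)
  (0≤w : ∀ i σ → 0ℚ ℚ.≤ w i σ) (fair : ∀ i → Fair (w i)) (q : ℚ) where

  Bounded : Pred String 0ℓ
  Bounded σ = ∀ k → ∑< k (λ i → w i σ) ℚ.≤ q

  bounded-step : ∀ σ → Bounded σ → ∃[ b ] Bounded (σ ▹ b)
  bounded-step σ bounded with em {Bounded (σ ▹ false)}
  ... | yes bounded₀ = false , bounded₀
  ... | no ¬bounded₀ = true , bounded₁
    where
    s : String → ℕ → ℚ
    s τ k = ∑< k (λ i → w i τ)

    impossible : ∀ k l → ¬ (q ℚ.< s (σ ▹ false) k × q ℚ.< s (σ ▹ true) l)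
    impossible k l (q<₀ , q<₁) = ℚ.<-irrefl refl (begin-strict
      q ℚ.+ q                           <⟨ ℚ.+-mono-< q<₀ q<₁ ⟩
      s (σ ▹ false) k ℚ.+ s (σ ▹ true) l ≤⟨ ℚ.+-mono-≤ (∑<-monoˡ (λ i → 0≤w i _) (ℕ.≤⇒≤′ (ℕ.m≤m⊔n k l))) (∑<-monoˡ (λ i → 0≤w i _) (ℕ.≤⇒≤′ (ℕ.m≤n⊔m k l))) ⟩
      s (σ ▹ false) n ℚ.+ s (σ ▹ true) n ≡⟨ ∑<-+ n ⟨
      ∑< n (λ i → w i (σ ▹ false) ℚ.+ w i (σ ▹ true)) ≡⟨ ∑<-cong n (λ i → fair i σ) ⟩
      ∑< n (λ i → w i σ ℚ.+ w i σ)      ≡⟨ ∑<-+ n ⟩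
      s σ n ℚ.+ s σ n                   ≤⟨ ℚ.+-mono-≤ (bounded n) (bounded n) ⟩
      q ℚ.+ q                           ∎)
      where
      open ℚ.≤-Reasoning
      n = k ℕ.⊔ l

    bounded₁ : Bounded (σ ▹ true)
    bounded₁ l with s (σ ▹ true) l ℚ.≤? q
    ... | yes ≤q = ≤q
    ... | no  ≰q = contradiction (λ k → ℚ.≮⇒≥ λ q<₀ → impossible k l (q<₀ , ℚ.≰⇒> ≰q)) ¬bounded₀

  -- Bounds at arbitrarily long prefixes of `Z` suffice for the applications: `W sel C` no longer
  -- changes once the prefix is as long as `C`.
  bounded-path : ∀ σ → Bounded σ → ∃[ Z ] σ ≺ Z × (∀ n → ∃[ N ] n ≤ N × Bounded (Z ↾ N))
  bounded-path σ bounded = Z , proj₂ limit 0 , λ n →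
    ∣ s n ∣ , longer n , subst Bounded (sym (proj₂ limit n)) (proj₂ (path n))
    where
    path : ℕ → ∃[ τ ] Bounded τ
    path zero    = σ , bounded
    path (suc n) = proj₁ (path n) ▹ proj₁ next-bit , proj₂ next-bit
      where next-bit = bounded-step (proj₁ (path n)) (proj₂ (path n))

    s : ℕ → String
    s n = proj₁ (path n)

    longer : ∀ n → n ≤ ∣ s n ∣
    longer zero    = z≤n
    longer (suc n) = s≤s (longer n)

    limit : ∃[ Z ] ∀ m → s m ≺ Z
    limit = chain-limit {s} (λ m → inj₂ (_ , refl)) (λ k → suc k , s≤s (longer k))

    Z = proj₁ limit

-- Transfer of measure along selections

module _ (sel : String → Bool) where

  -- `R` is read consecutively, but `Z` at the absolute position, skipping its bits at selected
  -- positions. This matches the way `W` copies from its second argument.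
  merge-bit : Cantor → Cantor → ℕ → String → Bool
  merge-bit R Z m τ = if sel τ then R ∣ select sel τ ∣ else Z m

  merge-↾ : Cantor → Cantor → ℕ → String
  merge-↾ R Z zero    = ε
  merge-↾ R Z (suc m) = merge-↾ R Z m ▹ merge-bit R Z m (merge-↾ R Z m)

  merge : Cantor → Cantor → Cantor
  merge R Z m = merge-bit R Z m (merge-↾ R Z m)

  ↾-merge : ∀ R Z m → merge R Z ↾ m ≡ merge-↾ R Z m
  ↾-merge R Z zero    = refl
  ↾-merge R Z (suc m) = cong (_▹ merge R Z m) (↾-merge R Z m)

  -- The string that R has to extend for merge R Z to extend C, if there is any.
  pull-bit : Bool → Bool → Bool → Maybe String → Maybe String
  pull-bit true  z b D = Maybe.map (_▹ b) D
  pull-bit false z b D = if does (z Bool.≟ b) then D else nothing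

  pull : Cantor → String → Maybe String
  pull Z ε       = just ε
  pull Z (C ▹ b) = pull-bit (sel C) (Z ∣ C ∣) b (pull Z C)

  -- A selected bit lengthens the pulled string by one and so contributes ½; any other bit
  -- contributes 1 or 0, according to whether it agrees with `Z`.
  weight-pull : ∀ Z C {n} → ∣ C ∣ ≤ n → weight (pull Z C) ≡ W sel C (Z ↾ n)
  weight-pull Z ε       _        = refl
  weight-pull Z (C ▹ b) {n} ∣C∣< = begin
    weight (pull-bit (sel C) (Z ∣ C ∣) b (pull Z C))
      ≡⟨ weight-pull-bit (sel C) (Z ∣ C ∣) (pull Z C) ⟩
    weight (pull Z C) ℚ.* factor sel (sel C) (just (Z ∣ C ∣)) b
      ≡⟨ cong₂ (λ p o → p ℚ.* factor sel (sel C) o b) (weight-pull Z C (ℕ.<⇒≤ ∣C∣<)) (sym (at-↾ Z ∣C∣<)) ⟩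
    W sel C (Z ↾ n) ℚ.* factor sel (sel C) (at (Z ↾ n) ∣ C ∣) b ∎
    where
    open ≡-Reasoning
    weight-pull-bit : ∀ s z D → weight (pull-bit s z b D) ≡ weight D ℚ.* factor sel s (just z) b
    weight-pull-bit true  z (just σ) = ℚ.*-comm ½ (2⁻ ∣ σ ∣)
    weight-pull-bit true  z nothing  = refl
    weight-pull-bit false z D with does (z Bool.≟ b)
    ... | true  = sym (ℚ.*-identityʳ (weight D))
    ... | false = sym (ℚ.*-zeroʳ (weight D))

  pull-merge : ∀ R Z m → pull Z (merge-↾ R Z m) ≡ just (select sel (merge-↾ R Z m)) ×
    select sel (merge-↾ R Z m) ≺ R
  pull-merge R Z zero    = refl , refl
  pull-merge R Z (suc m) with pull-merge R Z m
  ... | pulled , ≺R with sel (merge-↾ R Z m)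
  ...   | true  = cong (Maybe.map _) pulled , cong (_▹ R ∣ select sel (merge-↾ R Z m) ∣) ≺R
  ...   | false = trans (cong (λ d → if d then pull Z (merge-↾ R Z m) else nothing)
    (dec-true (Z ∣ merge-↾ R Z m ∣ Bool.≟ Z m) (cong Z (trans (cong ∣_∣ (sym (↾-merge R Z m))) (∣↾∣ _ m))))) pulled , ≺R

  -- The total weight of the cover pulled back along R ↦ merge R Z is, as a
  -- function of Z, a sum of martingales, so some Z does not increase it.
  lebesgue-merge : ExcludedMiddle 0ℓ → ∀ {S} q → lebesgue S q →
    lebesgue (λ R → ∀ Z → merge R Z ∈ S) q
  lebesgue-merge em {S} q μ = partialCovers⇒lebesgue {q = q} cover
    where
    cover : ∀ δ → 0ℚ ℚ.< δ → PartialCover (λ R → ∀ Z → merge R Z ∈ S) (q ℚ.+ δ)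
    cover δ 0<δ with μ δ 0<δ
    ... | C , covers , bound = (λ i → pull Z (C i)) , covers′ , bound′
      where
      -- The greedy choice starts from the weight of the given cover, as `W sel (C i) ε` is the
      -- measure of `⟦ C i ⟧`.
      path : ∃[ Z ] ε ≺ Z × (∀ n → ∃[ N ] n ≤ N × (∀ k → ∑< k (λ i → W sel (C i) (Z ↾ N)) ℚ.≤ q ℚ.+ δ))
      path = bounded-path em (λ i → W sel (C i)) (λ i → 0≤W sel (C i)) (λ i → W-fair sel (C i)) (q ℚ.+ δ) ε
        (λ k → ℚ.≤-trans (ℚ.≤-reflexive (∑<-cong k (λ i → W-ε sel (C i)))) (bound k))

      Z = proj₁ path

      -- A partial sum involves finitely many cylinders, so one prefix of `Z` is long enough for all
      -- of them.
      max : ∀ k → ∃[ n ] ∀ i → i < k → ∣ C i ∣ ≤ n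
      max zero    = 0 , λ _ ()
      max (suc k) with max k
      ... | n , ≤n = ∣ C k ∣ ℕ.⊔ n , λ i i<1+k → [ (λ i<k → ℕ.≤-trans (≤n i i<k) (ℕ.m≤n⊔m ∣ C k ∣ n)) ,
        (λ { refl → ℕ.m≤m⊔n ∣ C k ∣ n }) ]′ (ℕ.m≤n⇒m<n∨m≡n (ℕ.≤-pred i<1+k))

      bound′ : ∀ k → ∑< k (λ i → weight (pull Z (C i))) ℚ.≤ q ℚ.+ δ
      bound′ k with max k
      ... | n , ≤n with proj₂ (proj₂ path) n
      ...   | N , n≤N , ≤q+δ = ℚ.≤-trans
        (∑<-mono k λ i i<k → ℚ.≤-reflexive (weight-pull Z (C i) (ℕ.≤-trans (≤n i i<k) n≤N))) (≤q+δ k)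

      covers′ : ∀ R → (∀ Z → merge R Z ∈ S) → ∃[ i ] ∃[ σ ] pull Z (C i) ≡ just σ × R ∈ ⟦ σ ⟧
      covers′ R merge∈S with covers (merge R Z) (merge∈S Z)
      ... | i , Cᵢ≺ with pull-merge R Z ∣ C i ∣
      ...   | pulled , ≺R = i , _ , trans (cong (pull Z) (trans (sym Cᵢ≺) (↾-merge R Z ∣ C i ∣))) pulled , ≺R

-- With nothing selected, `W none C τ` is the conditional measure of `⟦ C ⟧` given `⟦ τ ⟧`.
none : String → Bool
none _ = false

W-none-prefix : ∀ {C Z} → C ≺ Z → ∀ {n} → ∣ C ∣ ℕ.≤′ n → W none C (Z ↾ n) ≡ 1ℚ
W-none-prefix {C} {Z} C≺Z ℕ.≤′-refl = subst (λ τ → W none C τ ≡ 1ℚ) (sym C≺Z) (W-self C)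
  where
  W-self : ∀ C → W none C C ≡ 1ℚ
  W-self ε       = refl
  W-self (C ▹ b) = cong₂ ℚ._*_ (trans (W-local none C b ℕ.≤-refl) (W-self C))
    (trans (cong (λ o → factor none false o b) (at-last C b)) (factor-same b))
    where
    factor-same : ∀ b → factor none false (just b) b ≡ 1ℚ
    factor-same false = refl
    factor-same true  = refl
W-none-prefix {C} {Z} C≺Z (ℕ.≤′-step {n = n} ≤n) =
  trans (W-local none C (Z n) (subst (∣ C ∣ ≤_) (sym (∣↾∣ Z n)) (ℕ.≤′⇒≤ ≤n))) (W-none-prefix C≺Z ≤n)

W-none-self : ∀ C → W none C C ≡ 1ℚ
W-none-self C = subst (λ τ → W none C τ ≡ 1ℚ) C≺X (W-none-prefix C≺X ℕ.≤′-refl)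
  where
  X : Cantor
  X k = fromMaybe false (at C k)
  C≺X : C ≺ X
  C≺X = at⇒≺ C X λ k b eq → cong (fromMaybe false) eq

-- For each cylinder `⟦ C ⟧` of a cover of `S`, the martingale `v C` bets on the selected bits only.
-- It starts at `2⁻ ∣ C ∣` and is 1 when the selected string is `C`, so Kolmogorov's inequality
-- bounds each preimage, and countable subadditivity their union.
lebesgue-select : ∀ (sel : String → Bool) {S} q → lebesgue S q →
  lebesgue (λ Y → ∃[ R ] R ∈ S × (∀ C → C ≺ R → ∃[ m ] select sel (Y ↾ m) ≡ C)) q
lebesgue-select sel {S} q μ = lebesgue-inf {q = q} λ δ 0<δ → let C , covers , bound = μ δ 0<δ in
  lebesgue-mono (q ℚ.+ δ)
    (λ { (R , R∈S , reaches) → let i , Cᵢ≺R = covers R R∈S ; m , eq = reaches (C i) Cᵢ≺R in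
      i , m , ℚ.≤-reflexive (sym (trans (cong (W none (C i)) eq) (W-none-self (C i)))) })
    (lebesgue-⋃ (λ i Y → ∃[ n ] 1ℚ ℚ.≤ v (C i) (Y ↾ n)) (λ i → 2⁻ ∣ C i ∣) {q ℚ.+ δ}
      (λ i → subst (lebesgue _) (W-ε none (C i)) (lebesgue-hit (v (C i)) (λ τ → 0≤W none (C i) _) (v-fair (C i))))
      bound)
  where
  v : String → String → ℚ
  v C τ = W none C (select sel τ)

  v-fair : ∀ C → Fair (v C)
  v-fair C τ with sel τ
  ... | true  = W-fair none C (select sel τ)
  ... | false = refl

-- A nonnegative martingale at most doubles with each bit.
2⁻-*-fair : ∀ v → (∀ σ → 0ℚ ℚ.≤ v σ) → Fair v → ∀ σ → 2⁻ ∣ σ ∣ ℚ.* v σ ℚ.≤ v ε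
2⁻-*-fair v 0≤v fair ε       = ℚ.≤-reflexive (ℚ.*-identityˡ (v ε))
2⁻-*-fair v 0≤v fair (σ ▹ b) = begin
  (½ ℚ.* p) ℚ.* v (σ ▹ b)                             ≤⟨ ℚ.*-monoˡ-≤-nonNeg (½ ℚ.* p) ⦃ ℚ.nonNegative (0≤2⁻ ∣ σ ▹ b ∣) ⦄ (child≤ b) ⟩
  (½ ℚ.* p) ℚ.* (v (σ ▹ false) ℚ.+ v (σ ▹ true))      ≡⟨ cong ((½ ℚ.* p) ℚ.*_) (fair σ) ⟩
  (½ ℚ.* p) ℚ.* (v σ ℚ.+ v σ)                         ≡⟨ solve 2 (λ p x → (con ½ :* p) :* (x :+ x) := p :* x) refl p (v σ) ⟩
  p ℚ.* v σ                                           ≤⟨ 2⁻-*-fair v 0≤v fair σ ⟩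
  v ε                                                 ∎
  where
  open ℚ.≤-Reasoning
  p = 2⁻ ∣ σ ∣
  child≤ : ∀ b → v (σ ▹ b) ℚ.≤ v (σ ▹ false) ℚ.+ v (σ ▹ true)
  child≤ false = p≤p+q (0≤v _)
  child≤ true  = subst (v (σ ▹ true) ℚ.≤_) (ℚ.+-comm (v (σ ▹ true)) _) (p≤p+q (0≤v _))

-- A greedy path from `ρ` keeps the sum of the `w i` at most `r`. On a path that enters some
-- `⟦ C i ⟧`, the single term `w i` would eventually be `2⁻ ∣ ρ ∣`, which exceeds `r`.
lebesgue-avoid : ExcludedMiddle 0ℓ → ∀ {S q} ρ → lebesgue S q → q ℚ.< 2⁻ ∣ ρ ∣ →
  ∃[ R ] ρ ≺ R × R ∉ S
lebesgue-avoid em {S} {q} ρ μ q<2⁻ = Z , ρ≺Z , λ Z∈S →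
  let i , Cᵢ≺Z   = covers Z Z∈S
      N , n≤N , bounded = bounds ∣ C i ∣
      p          = 2⁻ ∣ ρ ∣
  in ℚ.<-irrefl refl (ℚ.≤-<-trans (begin
    p                                 ≡⟨ ℚ.*-identityʳ p ⟨
    p ℚ.* 1ℚ                          ≡⟨ cong (p ℚ.*_) (W-none-prefix Cᵢ≺Z (ℕ.≤⇒≤′ n≤N)) ⟨
    w i (Z ↾ N)                       ≤⟨ term≤∑< (λ i → 0≤w i (Z ↾ N)) i ⟩
    ∑< (suc i) (λ i → w i (Z ↾ N))    ≤⟨ bounded (suc i) ⟩
    r                                 ∎) r<2⁻)
  where
  open ℚ.≤-Reasoning
  -- The gap is split: `r ℚ.- q` is the slack of the cover, and `r` stays strictly below `2⁻ ∣ ρ ∣`.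
  between : ∃[ r ] q ℚ.< r × r ℚ.< 2⁻ ∣ ρ ∣
  between = ℚ.<-dense q<2⁻
  r = proj₁ between
  r<2⁻ = proj₂ (proj₂ between)

  cover = μ (r ℚ.- q) (subst (ℚ._< r ℚ.- q) (ℚ.+-inverseʳ q) (ℚ.+-monoˡ-< (ℚ.- q) (proj₁ (proj₂ between))))
  C = proj₁ cover
  covers = proj₁ (proj₂ cover)

  -- With this scaling, `w i ρ` is the measure of the intersection of `⟦ C i ⟧` and `⟦ ρ ⟧`, hence
  -- at most `2⁻ ∣ C i ∣`.
  w : ℕ → String → ℚ
  w i τ = 2⁻ ∣ ρ ∣ ℚ.* W none (C i) τ

  0≤w : ∀ i τ → 0ℚ ℚ.≤ w i τ
  0≤w i τ = *-nonNeg (0≤2⁻ ∣ ρ ∣) (0≤W none (C i) τ)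

  w-fair : ∀ i → Fair (w i)
  w-fair i τ = trans (sym (ℚ.*-distribˡ-+ p _ _))
    (trans (cong (p ℚ.*_) (W-fair none (C i) τ)) (ℚ.*-distribˡ-+ p _ _))
    where p = 2⁻ ∣ ρ ∣

  initial : ∀ k → ∑< k (λ i → w i ρ) ℚ.≤ r
  initial k = begin
    ∑< k (λ i → w i ρ)        ≤⟨ ∑<-mono k (λ i _ → 2⁻-*-fair (W none (C i)) (0≤W none (C i)) (W-fair none (C i)) ρ) ⟩
    ∑< k (λ i → W none (C i) ε) ≡⟨ ∑<-cong k (λ i → W-ε none (C i)) ⟩
    ∑< k (λ i → 2⁻ ∣ C i ∣)   ≤⟨ proj₂ (proj₂ cover) k ⟩
    q ℚ.+ (r ℚ.- q)           ≡⟨ solve 2 (λ q r → q :+ (r :- q) := r) refl q r ⟩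
    r                         ∎

  path = bounded-path em w 0≤w w-fair r ρ initial
  Z = proj₁ path
  ρ≺Z = proj₁ (proj₂ path)
  bounds = proj₂ (proj₂ path)

-- Recursive functions

module _ {A : Pred String 0ℓ} where

  -- The argument is a variable `c` because matching would otherwise have to unify two values of the
  -- function `code`.
  oracle-inversion : ∀ {c y} → A ⊢ oracle · (c ∷ []) ⇓ y →
    ∃[ σ ] code σ ≡ c × ((σ ∈ A × y ≡ 1) ⊎ (σ ∉ A × y ≡ 0))
  oracle-inversion (yes⇓ σ∈A) = _ , refl , inj₁ (σ∈A , refl)
  oracle-inversion (no⇓ σ∉A)  = _ , refl , inj₂ (σ∉A , refl)

  ⇓-deterministic : ∀ {n} {e : Rec n} {xs y z} → A ⊢ e · xs ⇓ y → A ⊢ e · xs ⇓ z → y ≡ z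
  ⇓-deterministic* : ∀ {m n} {gs : Vec (Rec n) m} {xs ys zs} →
    Pointwise (λ g y → A ⊢ g · xs ⇓ y) gs ys → Pointwise (λ g z → A ⊢ g · xs ⇓ z) gs zs → ys ≡ zs

  ⇓-deterministic zero⇓ zero⇓ = refl
  ⇓-deterministic succ⇓ succ⇓ = refl
  ⇓-deterministic proj⇓ proj⇓ = refl
  ⇓-deterministic (yes⇓ σ∈A) d with oracle-inversion d
  ... | τ , eq , inj₁ (_ , refl)   = refl
  ... | τ , eq , inj₂ (τ∉A , refl) = contradiction (subst (_∈ A) (sym (code-injective eq)) σ∈A) τ∉A
  ⇓-deterministic (no⇓ σ∉A) d with oracle-inversion d
  ... | τ , eq , inj₁ (τ∈A , refl) = contradiction (subst (_∈ A) (code-injective eq) τ∈A) σ∉A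
  ... | τ , eq , inj₂ (_ , refl)   = refl
  ⇓-deterministic (comp⇓ gs f) (comp⇓ gs′ f′) with refl ← ⇓-deterministic* gs gs′ = ⇓-deterministic f f′
  ⇓-deterministic (prec0⇓ f) (prec0⇓ f′) = ⇓-deterministic f f′
  ⇓-deterministic (precS⇓ r g) (precS⇓ r′ g′) with refl ← ⇓-deterministic r r′ = ⇓-deterministic g g′
  ⇓-deterministic (min⇓ {k = k} before f) (min⇓ {k = l} before′ f′) with ℕ.<-cmp k l
  ... | tri≈ _ k≡l _ = k≡l
  ... | tri< k<l _ _ = contradiction (⇓-deterministic (proj₂ (before′ k k<l)) f) λ ()
  ... | tri> _ _ l<k = contradiction (⇓-deterministic (proj₂ (before l l<k)) f′) λ ()

  ⇓-deterministic* []       []         = refl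
  ⇓-deterministic* (g ∷ gs) (g′ ∷ gs′) = cong₂ _∷_ (⇓-deterministic g g′) (⇓-deterministic* gs gs′)

-- Primitive recursion on codes of strings

natrec : ℕ → (ℕ → ℕ → ℕ) → ℕ → ℕ
natrec z s zero    = z
natrec z s (suc n) = s n (natrec z s n)

bit : Bool → ℕ
bit false = 0
bit true  = 1

-- Written with the schemes of Rec, so that programs for them are read off.

flip pre parity halve parent lastbit : ℕ → ℕ
plus sub snoc anc : ℕ → ℕ → ℕ
cond : ℕ → ℕ → ℕ → ℕ

flip       = natrec 1 (λ _ _ → 0)
pre        = natrec 0 (λ k _ → k)
plus x     = natrec x (λ _ r → suc r)
sub x      = natrec x (λ _ r → pre r)
cond x y z = natrec z (λ _ _ → y) x
parity     = natrec 0 (λ _ r → flip r)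
halve      = natrec 0 (λ k r → plus r (parity k))
parent c   = halve (pre c)
lastbit c  = parity (pre c)
snoc c b   = suc (plus b (plus c c))
anc c      = natrec c (λ _ r → parent r)

plus≡+ : ∀ x y → plus x y ≡ x + y
plus≡+ x zero    = sym (ℕ.+-identityʳ x)
plus≡+ x (suc y) = trans (cong suc (plus≡+ x y)) (sym (ℕ.+-suc x y))

sub≡∸ : ∀ x y → sub x y ≡ x ∸ y
sub≡∸ x zero    = refl
sub≡∸ x (suc y) = trans (trans (cong pre (sub≡∸ x y)) (pre≡pred (x ∸ y))) (ℕ.pred[m∸n]≡m∸[1+n] x y)
  where
  pre≡pred : ∀ n → pre n ≡ ℕ.pred n
  pre≡pred zero    = refl
  pre≡pred (suc n) = refl

parity-double : ∀ n → parity (n + n) ≡ 0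
parity-double zero    = refl
parity-double (suc n) rewrite ℕ.+-suc n n | parity-double n = refl

halve-double : ∀ n → halve (n + n) ≡ n
halve-double zero    = refl
halve-double (suc n) rewrite ℕ.+-suc n n | parity-double n | halve-double n = refl

-- In this form the last bit and the parent are the parity and the half of the predecessor.
code-▹ : ∀ σ b → code (σ ▹ b) ≡ suc (bit b + (code σ + code σ))
code-▹ σ false = cong (λ c → suc (code σ + c)) (ℕ.+-identityʳ (code σ))
code-▹ σ true  = cong (λ c → suc (suc (code σ + c))) (ℕ.+-identityʳ (code σ))

snoc-code : ∀ σ b → snoc (code σ) (bit b) ≡ code (σ ▹ b)
snoc-code σ b = trans (cong suc (trans (plus≡+ (bit b) _) (cong (bit b +_) (plus≡+ (code σ) (code σ))))) (sym (code-▹ σ b))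

parent-▹ : ∀ σ b → parent (code (σ ▹ b)) ≡ code σ
parent-▹ σ b = trans (cong parent (code-▹ σ b)) (halve-bit b)
  where
  n = code σ
  halve-bit : ∀ b → halve (bit b + (n + n)) ≡ n
  halve-bit false = halve-double n
  halve-bit true  rewrite parity-double n | halve-double n = refl

lastbit-▹ : ∀ σ b → lastbit (code (σ ▹ b)) ≡ bit b
lastbit-▹ σ b = trans (cong lastbit (code-▹ σ b)) (parity-bit b)
  where
  n = code σ
  parity-bit : ∀ b → parity (bit b + (n + n)) ≡ bit b
  parity-bit false = parity-double n
  parity-bit true  rewrite parity-double n = refl

init : String → String
init ε       = ε
init (σ ▹ _) = σ

drop : String → ℕ → String
drop σ zero    = σ
drop σ (suc j) = init (drop σ j)

drop-▹ : ∀ σ b j → drop (σ ▹ b) (suc j) ≡ drop σ j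
drop-▹ σ b zero    = refl
drop-▹ σ b (suc j) = cong init (drop-▹ σ b j)

drop-all : ∀ σ {j} → ∣ σ ∣ ≤ j → drop σ j ≡ ε
drop-all ε       {zero}  _       = refl
drop-all ε       {suc j} _       = cong init (drop-all ε {j} z≤n)
drop-all (σ ▹ b) {suc j} (s≤s ≤j) = trans (drop-▹ σ b j) (drop-all σ ≤j)

drop-↾ : ∀ X n j → drop (X ↾ n) j ≡ X ↾ (n ∸ j)
drop-↾ X n       zero    = refl
drop-↾ X zero    (suc j) = trans (cong init (drop-↾ X zero j)) (cong (λ k → init (X ↾ k)) (ℕ.0∸n≡0 j))
drop-↾ X (suc n) (suc j) = trans (drop-▹ (X ↾ n) (X n) j) (drop-↾ X n j)

parent-init : ∀ σ → parent (code σ) ≡ code (init σ)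
parent-init ε       = refl
parent-init (σ ▹ b) = parent-▹ σ b

anc-drop : ∀ σ j → anc (code σ) j ≡ code (drop σ j)
anc-drop σ zero    = refl
anc-drop σ (suc j) = trans (cong parent (anc-drop σ j)) (parent-init (drop σ j))

∣∣≤code : ∀ σ → ∣ σ ∣ ≤ code σ
∣∣≤code ε       = z≤n
∣∣≤code (σ ▹ b) = subst (suc ∣ σ ∣ ≤_) (sym (code-▹ σ b))
  (s≤s (ℕ.≤-trans (∣∣≤code σ) (ℕ.≤-trans (ℕ.m≤m+n (code σ) (code σ)) (ℕ.m≤n+m _ (bit b)))))

∸-suc : ∀ {m n} → m < n → n ∸ m ≡ suc (n ∸ suc m)
∸-suc {zero}  {suc n} _         = refl
∸-suc {suc m} {suc n} (s≤s m<n) = ∸-suc m<n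

fold-step : ℕ → (ℕ → ℕ → ℕ → ℕ) → ℕ → ℕ → ℕ
fold-step z g p r = cond p (g (parent p) (lastbit p) r) z

-- The recursion runs through the prefixes of the string with code c: the one
-- at stage j is obtained by deleting c ∸ j bits (c is at least the length).
fold : ℕ → (ℕ → ℕ → ℕ → ℕ) → ℕ → ℕ
fold z g c = natrec z (λ j r → fold-step z g (anc c (sub c (suc j))) r) c

fold-code : ∀ {z} g (F : String → ℕ) → F ε ≡ z →
  (∀ σ b → F (σ ▹ b) ≡ g (code σ) (bit b) (F σ)) → ∀ σ → fold z g (code σ) ≡ F σ
fold-code {z} g F F-ε F-▹ σ =
  trans (stage (code σ) ℕ.≤-refl) (cong (λ k → F (drop σ k)) (ℕ.n∸n≡0 (code σ)))
  where
  c = code σ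
  step-correct : ∀ τ → fold-step z g (code τ) (F (init τ)) ≡ F τ
  -- While all bits are still deleted, the code is 0 and `cond` returns `z` again, so the surplus
  -- stages do no harm.
  step-correct ε       = sym F-ε
  step-correct (τ ▹ b) = trans (cond-code τ b) (trans
    (cong₂ (λ p l → g p l (F τ)) (parent-▹ τ b) (lastbit-▹ τ b)) (sym (F-▹ τ b)))
    where
    cond-code : ∀ τ b {x y} → cond (code (τ ▹ b)) x y ≡ x
    cond-code τ false = refl
    cond-code τ true  = refl

  stage : ∀ j → j ≤ c → natrec z (λ j r → fold-step z g (anc c (sub c (suc j))) r) j ≡ F (drop σ (c ∸ j))
  stage zero    _   = trans (sym F-ε) (cong F (sym (drop-all σ (∣∣≤code σ))))
  stage (suc j) j<c = trans
    (cong₂ (fold-step z g) (trans (cong (anc c) (sub≡∸ c (suc j))) (anc-drop σ (c ∸ suc j)))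
      (trans (stage j (ℕ.<⇒≤ j<c)) (cong (λ k → F (drop σ k)) (∸-suc j<c))))
    (step-correct (drop σ (c ∸ suc j)))

-- Programs relative to an oracle

module Computability (A : Pred String 0ℓ) where

  -- A program is paired with its correctness on all inputs, so that the combinators below build
  -- both along the definition of the function.
  Computes : ∀ {n} → (Vec ℕ n → ℕ) → Set
  Computes {n} f = Σ[ e ∈ Rec n ] ∀ xs → A ⊢ e · xs ⇓ f xs

  Computes₁ : (ℕ → ℕ) → Set
  Computes₁ f = Σ[ e ∈ Rec 1 ] ∀ x → A ⊢ e · (x ∷ []) ⇓ f x

  Computes₂ : (ℕ → ℕ → ℕ) → Set
  Computes₂ f = Σ[ e ∈ Rec 2 ] ∀ x y → A ⊢ e · (x ∷ y ∷ []) ⇓ f x y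

  Computes₃ : (ℕ → ℕ → ℕ → ℕ) → Set
  Computes₃ f = Σ[ e ∈ Rec 3 ] ∀ x y z → A ⊢ e · (x ∷ y ∷ z ∷ []) ⇓ f x y z

  close₁ : ∀ {f} → Computes {1} f → Computes₁ (λ x → f (x ∷ []))
  close₁ (e , e⇓) = e , λ x → e⇓ (x ∷ [])

  close₂ : ∀ {f} → Computes {2} f → Computes₂ (λ x y → f (x ∷ y ∷ []))
  close₂ (e , e⇓) = e , λ x y → e⇓ (x ∷ y ∷ [])

  close₃ : ∀ {f} → Computes {3} f → Computes₃ (λ x y z → f (x ∷ y ∷ z ∷ []))
  close₃ (e , e⇓) = e , λ x y z → e⇓ (x ∷ y ∷ z ∷ [])

  computes₁-≗ : ∀ {f g} → f ≗ g → Computes₁ f → Computes₁ g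
  computes₁-≗ f≗g (e , e⇓) = e , λ x → subst (A ⊢ e · (x ∷ []) ⇓_) (f≗g x) (e⇓ x)

  module _ {n : ℕ} where

    var : (i : Fin n) → Computes (λ xs → lookup xs i)
    var i = proj i , λ xs → proj⇓

    app₁ : ∀ {f g} → Computes₁ f → Computes {n} g → Computes (λ xs → f (g xs))
    app₁ (e , e⇓) (d , d⇓) = comp e (d ∷ []) , λ xs → comp⇓ (d⇓ xs ∷ []) (e⇓ _)

    app₂ : ∀ {f g h} → Computes₂ f → Computes {n} g → Computes {n} h → Computes (λ xs → f (g xs) (h xs))
    app₂ (e , e⇓) (d , d⇓) (c , c⇓) = comp e (d ∷ c ∷ []) , λ xs → comp⇓ (d⇓ xs ∷ c⇓ xs ∷ []) (e⇓ _ _)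

    app₃ : ∀ {f g h k} → Computes₃ f → Computes {n} g → Computes {n} h → Computes {n} k →
      Computes (λ xs → f (g xs) (h xs) (k xs))
    app₃ (e , e⇓) (d , d⇓) (c , c⇓) (b , b⇓) =
      comp e (d ∷ c ∷ b ∷ []) , λ xs → comp⇓ (d⇓ xs ∷ c⇓ xs ∷ b⇓ xs ∷ []) (e⇓ _ _ _)

    suc-c : ∀ {f} → Computes {n} f → Computes (λ xs → suc (f xs))
    suc-c = app₁ (succ , λ x → succ⇓)

    const-c : ∀ c → Computes {n} (λ _ → c)
    const-c zero    = comp zero [] , λ xs → comp⇓ [] zero⇓
    const-c (suc c) = suc-c (const-c c)

    natrec-c : ∀ {z s t} → Computes {n} z → Computes {suc (suc n)} s → Computes {n} t →
      Computes (λ xs → natrec (z xs) (λ k r → s (k ∷ r ∷ xs)) (t xs))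
    -- `tabulate proj` hands all arguments on as parameters of the recursion.
    natrec-c {z} {s} {t} (e , e⇓) (d , d⇓) (c , c⇓) = comp (prec e d) (c ∷ tabulate proj) , λ xs →
      comp⇓ (c⇓ xs ∷ subst (Pointwise _ (tabulate proj)) (tabulate∘lookup xs) (Pointwise.tabulate⁺ λ i → proj⇓))
        (loop xs (t xs))
      where
      loop : ∀ xs k → A ⊢ prec e d · (k ∷ xs) ⇓ natrec (z xs) (λ k r → s (k ∷ r ∷ xs)) k
      loop xs zero    = prec0⇓ (e⇓ xs)
      loop xs (suc k) = precS⇓ (loop xs k) (d⇓ _)

  flip-c : Computes₁ flip
  flip-c = close₁ (natrec-c (const-c 1) (const-c 0) (var 0F))

  pre-c : Computes₁ pre
  pre-c = close₁ (natrec-c (const-c 0) (var 0F) (var 0F))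

  plus-c : Computes₂ plus
  plus-c = close₂ (natrec-c (var 0F) (suc-c (var 1F)) (var 1F))

  sub-c : Computes₂ sub
  sub-c = close₂ (natrec-c (var 0F) (app₁ pre-c (var 1F)) (var 1F))

  cond-c : Computes₃ cond
  cond-c = close₃ (natrec-c (var 2F) (var 3F) (var 0F))

  parity-c : Computes₁ parity
  parity-c = close₁ (natrec-c (const-c 0) (app₁ flip-c (var 1F)) (var 0F))

  halve-c : Computes₁ halve
  halve-c = close₁ (natrec-c (const-c 0) (app₂ plus-c (var 1F) (app₁ parity-c (var 0F))) (var 0F))

  parent-c : Computes₁ parent
  parent-c = close₁ (app₁ halve-c (app₁ pre-c (var 0F)))

  lastbit-c : Computes₁ lastbit
  lastbit-c = close₁ (app₁ parity-c (app₁ pre-c (var 0F)))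

  snoc-c : Computes₂ snoc
  snoc-c = close₂ (suc-c (app₂ plus-c (var 1F) (app₂ plus-c (var 0F) (var 0F))))

  anc-c : Computes₂ anc
  anc-c = close₂ (natrec-c (var 0F) (app₁ parent-c (var 1F)) (var 1F))

  fold-c : ∀ z {g} → Computes₃ g → Computes₁ (fold z g)
  fold-c z g-c = close₁ (natrec-c (const-c z)
    (app₃ cond-c p-c (app₃ g-c (app₁ parent-c p-c) (app₁ lastbit-c p-c) (var 1F)) (const-c z))
    (var 0F))
    where p-c = app₂ anc-c (var 2F) (app₂ sub-c (var 2F) (suc-c (var 0F)))

  string-fold-c : ∀ {g} (F : String → ℕ) → Computes₃ g →
    (∀ σ b → F (σ ▹ b) ≡ g (code σ) (bit b) (F σ)) → Computes₁ (λ c → F (decode c))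
  string-fold-c {g} F g-c F-▹ = computes₁-≗
    (λ c → trans (cong (fold (F ε) g) (sym (code-decode c))) (fold-code g F refl F-▹ (decode c)))
    (fold-c (F ε) g-c)

  length-c : Computes₁ (λ c → ∣ decode c ∣)
  length-c = string-fold-c ∣_∣ (close₃ (suc-c (var 2F))) λ σ b → refl

  member : ExcludedMiddle 0ℓ → ℕ → ℕ
  member em c = bit (does (em {decode c ∈ A}))

  member-c : (em : ExcludedMiddle 0ℓ) → Computes₁ (member em)
  member-c em = oracle , λ c → subst (λ d → A ⊢ oracle · (d ∷ []) ⇓ member em c) (code-decode c) (answer (decode c))
    where
    answer : ∀ σ → A ⊢ oracle · (code σ ∷ []) ⇓ bit (does (em {σ ∈ A}))
    answer σ with em {σ ∈ A}
    ... | yes σ∈A = yes⇓ σ∈A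
    ... | no  σ∉A = no⇓ σ∉A

  domain : Rec 2 → ℕ → Pred Cantor 0ℓ
  domain e n X = ∃[ σ ] (A ⊢ e · (n ∷ code σ ∷ []) ↓) × X ∈ ⟦ σ ⟧

  -- Since `f` is total, the composed program halts exactly when `e` halts on the translated code.
  -- Tests are pulled back in this way along maps of strings.
  preimage-ceOpen : ∀ {f} → Computes₁ f → ∀ e → UniformlyCEOpen A
    (λ n X → ∃[ σ ] (A ⊢ e · (n ∷ f (code σ) ∷ []) ↓) × X ∈ ⟦ σ ⟧)
  preimage-ceOpen {f} f-c@(d , d⇓) e = e′ , λ n X →
    mk⇔ (λ { (σ , (y , e⇓) , σ≺X) → σ , (y , comp⇓ (proj⇓ ∷ proj₂ arg-c _ ∷ []) e⇓) , σ≺X })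
        (λ { (σ , (y , e′⇓) , σ≺X) → σ , (y , inversion e′⇓) , σ≺X })
    where
    arg-c : Computes {2} (λ xs → f (lookup xs 1F))
    arg-c = app₁ f-c (var 1F)
    e′ : Rec 2
    e′ = comp e (proj 0F ∷ proj₁ arg-c ∷ [])
    inversion : ∀ {n c y} → A ⊢ e′ · (n ∷ c ∷ []) ⇓ y → A ⊢ e · (n ∷ f c ∷ []) ⇓ y
    inversion (comp⇓ (proj⇓ ∷ arg⇓ ∷ []) e⇓) with refl ← ⇓-deterministic arg⇓ (proj₂ arg-c _) = e⇓

  -- The minimization ignores its search variable and repeats one oracle query: it stops at once on
  -- the answer 0 and never on the answer 1.
  complement-ceOpen : UniformlyCEOpen A (λ _ X → ∃[ σ ] σ ∉ A × X ∈ ⟦ σ ⟧)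
  complement-ceOpen = μ-min (comp oracle (proj 2F ∷ [])) , λ n X →
    mk⇔ (λ { (σ , σ∉A , σ≺X) → σ , (0 , min⇓ (λ _ ()) (comp⇓ (proj⇓ ∷ []) (no⇓ σ∉A))) , σ≺X })
        (λ { (σ , (y , e⇓) , σ≺X) → σ , inversion e⇓ , σ≺X })
    where
    inversion : ∀ {n σ y} → A ⊢ μ-min (comp oracle (proj 2F ∷ [])) · (n ∷ code σ ∷ []) ⇓ y → σ ∉ A
    inversion (min⇓ _ (comp⇓ (proj⇓ ∷ []) o⇓)) with oracle-inversion o⇓
    ... | τ , eq , inj₂ (τ∉A , _) = subst (_∉ A) (code-injective eq) τ∉A

-- Existence of random sequences

-- The top of the stack is the end of the string; a number is written in unary, as ones that follow
-- a zero.
push : ℕ → String → String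
push zero    s = s ▹ false
push (suc k) s = push k s ▹ true

pop : String → ℕ × String
pop ε           = 0 , ε
pop (s ▹ false) = 0 , s
pop (s ▹ true)  = suc (proj₁ (pop s)) , proj₂ (pop s)

pop-push : ∀ k s → pop (push k s) ≡ (k , s)
pop-push zero    s = refl
pop-push (suc k) s = cong (λ p → suc (proj₁ p) , proj₂ p) (pop-push k s)

-- Programs are written onto a stack of numbers in Polish notation.
encode : ∀ {n} → Rec n → String → String
encode* : ∀ {m n} → Vec (Rec n) m → String → String
encode zero               s = push 0 s
encode succ               s = push 1 s
encode (proj i)           s = push 2 (push (Fin.toℕ i) s)
encode oracle             s = push 3 s
encode (comp {m = m} f gs) s = push 4 (push m (encode f (encode* gs s)))
encode (prec f g)         s = push 5 (encode f (encode g s))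
encode (μ-min f)          s = push 6 (encode f s)
encode* []       s = s
encode* (g ∷ gs) s = encode g (encode* gs s)

-- The amount of fuel with which `parse` recovers a program.
depth : ∀ {n} → Rec n → ℕ
depth* : ∀ {m n} → Vec (Rec n) m → ℕ
depth (comp f gs) = suc (depth f ℕ.⊔ depth* gs)
depth (prec f g)  = suc (depth f ℕ.⊔ depth g)
depth (μ-min f)   = suc (depth f)
depth _           = 1
depth* []       = 0
depth* (g ∷ gs) = depth g ℕ.⊔ depth* gs

parse-proj : ∀ n → ℕ × String → Maybe (Rec n × String)
parse-proj n (k , s) with k ℕ.<? n
... | yes k<n = just (proj (Fin.fromℕ< k<n) , s)
... | no  _   = nothing

parse-proj-toℕ : ∀ {n} (i : Fin n) s → parse-proj n (Fin.toℕ i , s) ≡ just (proj i , s)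
parse-proj-toℕ {n} i s with Fin.toℕ i ℕ.<? n
... | yes i<n = cong (λ j → just (proj j , s)) (Fin.fromℕ<-toℕ i i<n)
... | no  i≮n = contradiction (Fin.toℕ<n i) i≮n

parse : ℕ → ∀ n → String → Maybe (Rec n × String)
parse-tag : ℕ → ℕ → ∀ n → String → Maybe (Rec n × String)
parse* : ℕ → ∀ n m → String → Maybe (Vec (Rec n) m × String)
parse zero    n s = nothing
parse (suc d) n s = parse-tag d (proj₁ (pop s)) n (proj₂ (pop s))
parse-tag d 0 0       s = just (zero , s)
parse-tag d 1 1       s = just (succ , s)
parse-tag d 2 n       s = parse-proj n (pop s)
parse-tag d 3 1       s = just (oracle , s)
parse-tag d 4 n       s =
  parse d (proj₁ (pop s)) (proj₂ (pop s)) >>= λ (f , t) →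
  parse* d n (proj₁ (pop s)) t >>= λ (gs , u) → just (comp f gs , u)
parse-tag d 5 (suc n) s =
  parse d n s >>= λ (f , t) → parse d (2 + n) t >>= λ (g , u) → just (prec f g , u)
parse-tag d 6 n       s = parse d (suc n) s >>= λ (f , t) → just (μ-min f , t)
parse-tag d _ _       s = nothing
parse* d n zero    s = just ([] , s)
parse* d n (suc m) s =
  parse d n s >>= λ (g , t) → parse* d n m t >>= λ (gs , u) → just (g ∷ gs , u)

parse-encode : ∀ {n} (e : Rec n) s {d} → depth e ≤ d → parse d n (encode e s) ≡ just (e , s)
parse-encode* : ∀ {m n} (gs : Vec (Rec n) m) s {d} → depth* gs ≤ d → parse* d n m (encode* gs s) ≡ just (gs , s)
parse-encode zero     s (s≤s _) = refl
parse-encode succ     s (s≤s _) = refl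
parse-encode {n} (proj i) s (s≤s _) =
  trans (cong (parse-proj n) (pop-push (Fin.toℕ i) s)) (parse-proj-toℕ i s)
parse-encode oracle   s (s≤s _) = refl
parse-encode (comp {m = m} f gs) s {suc d} (s≤s ≤d)
  rewrite pop-push m (encode f (encode* gs s))
        | parse-encode f (encode* gs s) (ℕ.m⊔n≤o⇒m≤o (depth f) (depth* gs) ≤d)
        | parse-encode* gs s (ℕ.m⊔n≤o⇒n≤o (depth f) (depth* gs) ≤d) = refl
parse-encode (prec f g) s (s≤s ≤d)
  rewrite parse-encode f (encode g s) (ℕ.m⊔n≤o⇒m≤o (depth f) (depth g) ≤d)
        | parse-encode g s (ℕ.m⊔n≤o⇒n≤o (depth f) (depth g) ≤d) = refl
parse-encode (μ-min f) s (s≤s ≤d) rewrite parse-encode f s ≤d = refl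
parse-encode* []       s _  = refl
parse-encode* (g ∷ gs) s ≤d
  rewrite parse-encode g (encode* gs s) (ℕ.m⊔n≤o⇒m≤o (depth g) (depth* gs) ≤d)
        | parse-encode* gs s (ℕ.m⊔n≤o⇒n≤o (depth g) (depth* gs) ≤d) = refl

-- The fuel is stored on top of the encoded program, so every program has an index.
program : ℕ → Maybe (Rec 2)
program i = Maybe.map proj₁ (parse (proj₁ (pop (decode i))) 2 (proj₂ (pop (decode i))))

program-surjective : ∀ e → ∃[ i ] program i ≡ just e
program-surjective e = code s , trans (cong (λ t → program′ (pop t)) (decode-code s))
  (trans (cong program′ (pop-push (depth e) (encode e ε))) (cong (Maybe.map proj₁) (parse-encode e ε ℕ.≤-refl)))
  where
  s = push (depth e) (encode e ε)
  program′ : ℕ × String → Maybe (Rec 2)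
  program′ (d , t) = Maybe.map proj₁ (parse d 2 t)

2⁻-suc< : ∀ n → 2⁻ suc n ℚ.< 2⁻ n
2⁻-suc< n = subst₂ ℚ._<_ (ℚ.+-identityʳ p) (+-halves (2⁻ n)) (ℚ.+-monoʳ-< p (0<2⁻ (suc n)))
  where p = 2⁻ suc n

-- The i-th program, if it is a test, is avoided at a level of measure 2^-(c+i+1).
random-extending : ExcludedMiddle 0ℓ → ∀ A ρ → ∃[ R ] ρ ≺ R × R ∈ MLR A lebesgue
random-extending em A ρ = random
  where
  open Computability A

  -- The levels `c + suc i` have total measure at most `2⁻ suc ∣ ρ ∣`, which is less than the
  -- measure of `⟦ ρ ⟧`.
  c : ℕ
  c = suc ∣ ρ ∣

  IsTest : Rec 2 → Set
  IsTest e = ∀ n → lebesgue (domain e n) (2⁻ n)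

  -- Indices that do not yield a test contribute the empty set.
  S : ℕ → Pred Cantor 0ℓ
  S i Y = ∃[ e ] program i ≡ just e × IsTest e × Y ∈ domain e (c + suc i)

  S-small : ∀ i → lebesgue (S i) (2⁻ (c + suc i))
  S-small i with em {∃[ e ] program i ≡ just e × IsTest e}
  ... | yes (e , eq , test) = lebesgue-mono (2⁻ (c + suc i))
    (λ { (e′ , eq′ , _ , Y∈) → subst (λ d → _ ∈ domain d (c + suc i)) (just-injective (trans (sym eq′) eq)) Y∈ })
    (test (c + suc i))
  ... | no  none-such = lebesgue-∅ (λ { Y (e , eq , test , _) → none-such (e , eq , test) }) (c + suc i)

  avoids⇒MLR : ∀ R → ¬ (∃[ i ] R ∈ S i) → R ∈ MLR A lebesgue
  avoids⇒MLR R R∉S U (e , spec) U-small R∈U with program-surjective e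
  ... | i , eq = R∉S (i , e , eq ,
    (λ n → lebesgue-mono (2⁻ n) (λ {X} X∈ → Equivalence.from (spec n X) X∈) (U-small n)) ,
    Equivalence.to (spec (c + suc i) R) (R∈U (c + suc i)))

  random : ∃[ R ] ρ ≺ R × R ∈ MLR A lebesgue
  random = let R , ρ≺R , R∉S = lebesgue-avoid em ρ (lebesgue-⋃ S (λ i → 2⁻ (c + suc i)) S-small (∑<-2⁻ c)) (2⁻-suc< ∣ ρ ∣)
    in R , ρ≺R , avoids⇒MLR R R∉S

-- Paths through T⟨ P ⟩

↾-cong : ∀ {X Y : Cantor} → X ≗ Y → ∀ n → X ↾ n ≡ Y ↾ n
↾-cong X≗Y zero    = refl
↾-cong X≗Y (suc n) = cong₂ _▹_ (↾-cong X≗Y n) (X≗Y n)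

module _ (em : ExcludedMiddle 0ℓ) (P : Pred Cantor 0ℓ) where

  private
    T : Pred String 0ℓ
    T = T⟨ P ⟩

    br : String → Bool
    br = branching em P

    nx : String → Bool → Bool
    nx = next em P

  T-child : ∀ σ → σ ∈ T → (σ ▹ false ∈ T) ⊎ (σ ▹ true ∈ T)
  T-child σ (X , X∈P , σ≺X) with X ∣ σ ∣ in eq
  ... | false = inj₁ (X , X∈P , cong₂ _▹_ σ≺X eq)
  ... | true  = inj₂ (X , X∈P , cong₂ _▹_ σ≺X eq)

  next-∈T : ∀ σ b → σ ∈ T → σ ▹ nx σ b ∈ T
  next-∈T σ b σ∈T with em {(σ ▹ false ∈ T) × (σ ▹ true ∈ T)}
  next-∈T σ false σ∈T | yes both = proj₁ both
  next-∈T σ true  σ∈T | yes both = proj₂ both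
  next-∈T σ b     σ∈T | no _ with em {σ ▹ false ∈ T}
  ... | yes σ0∈T = σ0∈T
  ... | no  σ0∉T with T-child σ σ∈T
  ...   | inj₁ σ0∈T = contradiction σ0∈T σ0∉T
  ...   | inj₂ σ1∈T = σ1∈T

  next-branching : ∀ σ b → br σ ≡ true → nx σ b ≡ b
  next-branching σ b eq rewrite eq = refl

  next-forced : ∀ σ b c → br σ ≡ false → nx σ b ≡ nx σ c
  next-forced σ b c eq rewrite eq = refl

  next-unique : ∀ σ b i → br σ ≡ false → σ ▹ i ∈ T → nx σ b ≡ i
  next-unique σ b i eq σi∈T with em {(σ ▹ false ∈ T) × (σ ▹ true ∈ T)}
  next-unique σ b i () σi∈T | yes _
  ... | no ¬both with em {σ ▹ false ∈ T}
  next-unique σ b false eq σi∈T | no ¬both | yes σ0∈T = refl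
  next-unique σ b true  eq σi∈T | no ¬both | yes σ0∈T = contradiction (σ0∈T , σi∈T) ¬both
  next-unique σ b false eq σi∈T | no ¬both | no  σ0∉T = contradiction σi∈T σ0∉T
  next-unique σ b true  eq σi∈T | no ¬both | no  σ0∉T = refl

  φ-∈T : ε ∈ T → ∀ τ → φ em P τ ∈ T
  φ-∈T ε∈T ε       = ε∈T
  φ-∈T ε∈T (τ ▹ b) = next-∈T (φ em P τ) b (φ-∈T ε∈T τ)

  -- For a prefix `σ` of `Ψ em P R` this is the part of `R` that has been read.
  bits : String → String
  bits = select br

  ∣bits∣ : ∀ σ → ∣ bits σ ∣ ≡ #branchings em P σ
  ∣bits∣ ε = refl
  ∣bits∣ (σ ▹ b) with br σ
  ... | true  = cong suc (∣bits∣ σ)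
  ... | false = ∣bits∣ σ

  brφ : String → Bool
  brφ τ = br (φ em P τ)

  -- At a branching `φ` copies its input bit, so it can be read off from the input or from the
  -- output.
  select-φ : ∀ τ → select brφ τ ≡ bits (φ em P τ)
  select-φ ε = refl
  select-φ (τ ▹ b) with br (φ em P τ)
  ... | true  = cong (_▹ b) (select-φ τ)
  ... | false = select-φ τ

  -- At a branching the bit read from `R` is the bit of `X` by the prefix hypothesis; elsewhere only
  -- one extension stays in `T`, and `X` takes it.
  bits-≺⇒ψ : ∀ {X R} → (∀ m → X ↾ m ∈ T) → (∀ m → bits (X ↾ m) ≺ R) → ∀ m → ψ em P R m ≡ X ↾ m
  bits-≺⇒ψ         X∈T ≺R zero    = refl
  bits-≺⇒ψ {X} {R} X∈T ≺R (suc m) rewrite bits-≺⇒ψ {X} {R} X∈T ≺R m = cong (X ↾ m ▹_) (step (br (X ↾ m)) refl)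
    where
    step : ∀ b → br (X ↾ m) ≡ b → nx (X ↾ m) (R (#branchings em P (X ↾ m))) ≡ X m
    step false eq = next-unique (X ↾ m) _ (X m) eq (X∈T (suc m))
    step true  eq = trans (next-branching (X ↾ m) _ eq) (trans (cong R (sym (∣bits∣ (X ↾ m))))
      (proj₂ (≺-parent (subst (λ d → (if d then bits (X ↾ m) ▹ X m else bits (X ↾ m)) ≺ R) eq (≺R (suc m))))))

  bits-≺⇒Ψ : ∀ {X R} → (∀ m → X ↾ m ∈ T) → (∀ m → bits (X ↾ m) ≺ R) → X ≗ Ψ em P R
  bits-≺⇒Ψ {X} {R} X∈T ≺R m = sym (proj₂ (▹-injective (bits-≺⇒ψ {X} {R} X∈T ≺R (suc m))))

  -- At branchings `merge` supplies the bit of `R` that `ψ` reads next; the bits of `Z` fall where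
  -- `φ` ignores its input.
  φ-merge : ∀ R Z m → φ em P (merge-↾ brφ R Z m) ≡ ψ em P R m
  φ-merge R Z zero    = refl
  φ-merge R Z (suc m) = trans (cong (σ ▹_) (same (br σ) refl))
    (cong (λ τ → τ ▹ nx τ (R (#branchings em P τ))) (φ-merge R Z m))
    where
    τ = merge-↾ brφ R Z m
    σ = φ em P τ
    same : ∀ b → br σ ≡ b → nx σ (merge-bit brφ R Z m τ) ≡ nx σ (R (#branchings em P σ))
    same false eq = next-forced σ _ _ eq
    same true  eq = cong (nx σ) (trans
      (cong (λ d → if d then R ∣ select brφ τ ∣ else Z m) eq)
      (cong R (trans (cong ∣_∣ (select-φ τ)) (∣bits∣ σ))))

  Φ-merge : ∀ R Z m → Φ em P (merge brφ R Z) ↾ m ≡ ψ em P R m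
  Φ-merge R Z m = trans (Φ-↾ em P (merge brφ R Z) m)
    (trans (cong (φ em P) (↾-merge brφ R Z m)) (φ-merge R Z m))

  ∣ψ∣ : ∀ R m → ∣ ψ em P R m ∣ ≡ m
  ∣ψ∣ R zero    = refl
  ∣ψ∣ R (suc m) = cong suc (∣ψ∣ R m)

  -- The extension of σ by n forced bits, as long as there are no branchings.
  extend : String → ℕ → String
  extend σ zero    = σ
  extend σ (suc n) = extend σ n ▹ nx (extend σ n) false

  Dead : Pred String 0ℓ
  Dead σ = ∀ n → br (extend σ n) ≡ false

  dead-next : ∀ σ b → Dead σ → Dead (σ ▹ nx σ b)
  dead-next σ b dead n = trans (cong br (trans
    (cong (λ c → extend (σ ▹ c) n) (next-forced σ b false (dead 0))) (shift n))) (dead (suc n))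
    where
    shift : ∀ n → extend (σ ▹ nx σ false) n ≡ extend σ (suc n)
    shift zero    = refl
    shift (suc n) = cong (λ τ → τ ▹ nx τ false) (shift n)

  -- Φ ignores the bits at nonbranching positions. Selecting also the bits
  -- after the last branching makes the selected subsequence infinite.
  live : String → Bool
  live τ = brφ τ ∨ does (em {Dead (φ em P τ)})

  -- If no position from `m` on were live, there would be no branching from `m` on, so
  -- `φ em P (Y ↾ m)` would be dead and `m` itself live.
  live-infinite : ∀ Y → Infinite live Y
  live-infinite Y m with em {∃[ n ] m ≤ n × live (Y ↾ n) ≡ true}
  ... | yes found = found
  ... | no  none-such = contradiction (m , ℕ.≤-refl , live-m) none-such
    where
    ¬live : ∀ n → m ≤ n → live (Y ↾ n) ≡ false
    ¬live n m≤n = Bool.¬-not λ live-n → none-such (n , m≤n , live-n)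

    ¬branching : ∀ n → brφ (Y ↾ (n + m)) ≡ false
    ¬branching n = Bool.∨-conicalˡ _ _ (¬live (n + m) (ℕ.m≤n+m m n))

    extend-φ : ∀ n → extend (φ em P (Y ↾ m)) n ≡ φ em P (Y ↾ (n + m))
    extend-φ zero    = refl
    extend-φ (suc n) = trans (cong (λ τ → τ ▹ nx τ false) (extend-φ n))
      (cong (φ em P (Y ↾ (n + m)) ▹_) (next-forced _ _ _ (¬branching n)))

    live-m : live (Y ↾ m) ≡ true
    live-m = trans (cong (brφ (Y ↾ m) ∨_) (dec-true (em {Dead (φ em P (Y ↾ m))})
      (λ n → trans (cong br (extend-φ n)) (¬branching n)))) (Bool.∨-zeroʳ _)

  -- The two selections agree until a dead string is reached. From then on the first one stops
  -- growing, and `k` is frozen.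
  bits-live : ∀ Y m → ∃[ k ] select brφ (Y ↾ m) ≡ select live (Y ↾ k) × (k ≡ m ⊎ Dead (φ em P (Y ↾ m)))
  bits-live Y zero    = 0 , refl , inj₁ refl
  bits-live Y (suc m) with bits-live Y m
  ... | k , eq , inj₂ dead = k , trans (select-false brφ (Y ↾ m) (Y m) (dead 0)) eq ,
    inj₂ (dead-next (φ em P (Y ↾ m)) (Y m) dead)
  ... | _ , eq , inj₁ refl = extended (brφ τ) refl (em {Dead (φ em P τ)})
    where
    τ = Y ↾ m
    extended : ∀ b → brφ τ ≡ b → Dec (Dead (φ em P τ)) →
      ∃[ k ] select brφ (Y ↾ suc m) ≡ select live (Y ↾ k) × (k ≡ suc m ⊎ Dead (φ em P (Y ↾ suc m)))
    extended true  br-m _          = suc m , trans (select-true brφ τ (Y m) br-m)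
      (trans (cong (_▹ Y m) eq) (sym (select-true live τ (Y m) (cong (_∨ does (em {Dead (φ em P τ)})) br-m)))) , inj₁ refl
    extended false br-m (yes dead) = m , trans (select-false brφ τ (Y m) br-m) eq ,
      inj₂ (dead-next (φ em P τ) (Y m) dead)
    extended false br-m (no ¬dead) = suc m , trans (select-false brφ τ (Y m) br-m)
      (trans eq (sym (select-false live τ (Y m) (cong₂ _∨_ br-m (dec-false em ¬dead))))) , inj₁ refl

  -- Computing `bits` and `ψ` from the oracle `T`

  module _ where
    open Computability T

    member-▹-c : ∀ b → Computes₁ (λ c → member em (snoc c (bit b)))
    member-▹-c b = close₁ (app₁ (member-c em) (app₂ snoc-c (var 0F) (const-c (bit b))))

    member-▹ : ∀ σ b → member em (snoc (code σ) (bit b)) ≡ bit (does (em {σ ▹ b ∈ T}))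
    member-▹ σ b = cong (λ τ → bit (does (em {τ ∈ T})))
      (trans (cong decode (snoc-code σ b)) (decode-code (σ ▹ b)))

    br-code nbits-code bits-code : ℕ → ℕ
    nbits-step bits-step : ℕ → ℕ → ℕ → ℕ
    br-code c        = cond (member em (snoc c 0)) (member em (snoc c 1)) 0
    nbits-step c b n = plus (br-code c) n
    nbits-code       = fold 0 nbits-step
    bits-step c b d  = cond (br-code c) (snoc d b) d
    bits-code        = fold 0 bits-step

    br-code-code : ∀ σ → br-code (code σ) ≡ bit (br σ)
    br-code-code σ = trans (cong₂ (λ x y → cond x y 0) (member-▹ σ false) (member-▹ σ true)) and
      where
      and : cond (bit (does (em {σ ▹ false ∈ T}))) (bit (does (em {σ ▹ true ∈ T}))) 0 ≡ bit (br σ)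
      and with em {σ ▹ false ∈ T} | em {σ ▹ true ∈ T} | em {(σ ▹ false ∈ T) × (σ ▹ true ∈ T)}
      ... | yes _  | yes _  | yes _    = refl
      ... | yes p  | yes q  | no ¬both = contradiction (p , q) ¬both
      ... | yes _  | no ¬q  | yes both = contradiction (proj₂ both) ¬q
      ... | yes _  | no _   | no _     = refl
      ... | no ¬p  | _      | yes both = contradiction (proj₁ both) ¬p
      ... | no _   | _      | no _     = refl

    cond-bit : ∀ b {x y} → cond (bit b) x y ≡ (if b then x else y)
    cond-bit false = refl
    cond-bit true  = refl

    nbits-code-code : ∀ σ → nbits-code (code σ) ≡ #branchings em P σ
    nbits-code-code = fold-code nbits-step (#branchings em P) refl λ σ b →
      sym (trans (plus≡+ (br-code (code σ)) _) (cong (_+ #branchings em P σ)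
        (trans (br-code-code σ) (bit-if (br σ)))))
      where
      bit-if : ∀ b → bit b ≡ (if b then 1 else 0)
      bit-if false = refl
      bit-if true  = refl

    bits-code-code : ∀ σ → bits-code (code σ) ≡ code (bits σ)
    bits-code-code = fold-code bits-step (λ σ → code (bits σ)) refl λ σ b →
      sym (trans (cong₂ (λ x y → cond x y (code (bits σ))) (br-code-code σ) (snoc-code (bits σ) b))
        (cond-code σ b (br σ)))
      where
      cond-code : ∀ σ b d → cond (bit d) (code (bits σ ▹ b)) (code (bits σ)) ≡ code (if d then bits σ ▹ b else bits σ)
      cond-code σ b false = refl
      cond-code σ b true  = refl

    next-code : ℕ → ℕ → ℕ
    next-code c b = cond (br-code c) b (flip (member em (snoc c 0)))

    next-code-code : ∀ σ b → next-code (code σ) (bit b) ≡ bit (nx σ b)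
    next-code-code σ b = trans
      (cong₂ (λ x y → cond x (bit b) (flip y)) (br-code-code σ) (member-▹ σ false))
      (trans (cond-bit (br σ)) (if-bit (br σ) (does (em {σ ▹ false ∈ T}))))
      where
      if-bit : ∀ d m → (if d then bit b else flip (bit m)) ≡ bit (if d then b else not m)
      if-bit false false = refl
      if-bit false true  = refl
      if-bit true  m     = refl

    -- Bit `k` is the last bit of the prefix of length `suc k`, which remains after deleting the
    -- rest.
    lookup-code : ℕ → ℕ → ℕ
    lookup-code ρ k = lastbit (anc ρ (sub ∣ decode ρ ∣ (suc k)))

    lookup-code-↾ : ∀ R {k m} → k < m → lookup-code (code (R ↾ m)) k ≡ bit (R k)
    lookup-code-↾ R {k} {m} k<m = begin
      lastbit (anc (code (R ↾ m)) (sub ∣ decode (code (R ↾ m)) ∣ (suc k)))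
        ≡⟨ cong (λ σ → lastbit (anc (code (R ↾ m)) (sub ∣ σ ∣ (suc k)))) (decode-code (R ↾ m)) ⟩
      lastbit (anc (code (R ↾ m)) (sub ∣ R ↾ m ∣ (suc k)))
        ≡⟨ cong (λ n → lastbit (anc (code (R ↾ m)) n)) (trans (sub≡∸ ∣ R ↾ m ∣ (suc k)) (cong (_∸ suc k) (∣↾∣ R m))) ⟩
      lastbit (anc (code (R ↾ m)) (m ∸ suc k))
        ≡⟨ cong lastbit (anc-drop (R ↾ m) (m ∸ suc k)) ⟩
      lastbit (code (drop (R ↾ m) (m ∸ suc k)))
        ≡⟨ cong (λ σ → lastbit (code σ)) (drop-↾ R m (m ∸ suc k)) ⟩
      lastbit (code (R ↾ (m ∸ (m ∸ suc k))))
        ≡⟨ cong (λ n → lastbit (code (R ↾ n))) (ℕ.m∸[m∸n]≡n k<m) ⟩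
      lastbit (code (R ↾ k ▹ R k))
        ≡⟨ lastbit-▹ (R ↾ k) (R k) ⟩
      bit (R k) ∎
      where open ≡-Reasoning

    ψ-step ψ-stage : ℕ → ℕ → ℕ
    ψ-step ρ s = snoc s (next-code s (lookup-code ρ (nbits-code s)))
    ψ-stage ρ  = natrec 0 (λ _ s → ψ-step ρ s)

    ψ-code : ℕ → ℕ
    ψ-code ρ = ψ-stage ρ ∣ decode ρ ∣

    #branchings≤ : ∀ σ → #branchings em P σ ≤ ∣ σ ∣
    #branchings≤ ε = z≤n
    #branchings≤ (σ ▹ b) with br σ
    ... | true  = s≤s (#branchings≤ σ)
    ... | false = ℕ.m≤n⇒m≤1+n (#branchings≤ σ)

    -- A string of length `j` passes at most `j` branchings, so every bit of `R` needed at a stage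
    -- `j < m` already occurs in `R ↾ m`.
    ψ-code-↾ : ∀ R m → ψ-code (code (R ↾ m)) ≡ code (ψ em P R m)
    ψ-code-↾ R m = trans (cong (ψ-stage ρ) (trans (cong ∣_∣ (decode-code (R ↾ m))) (∣↾∣ R m))) (stage m ℕ.≤-refl)
      where
      ρ = code (R ↾ m)
      stage : ∀ j → j ≤ m → ψ-stage ρ j ≡ code (ψ em P R j)
      stage zero    _   = refl
      stage (suc j) j<m = begin
        ψ-step ρ (ψ-stage ρ j)                                  ≡⟨ cong (ψ-step ρ) (stage j (ℕ.<⇒≤ j<m)) ⟩
        snoc (code σ) (next-code (code σ) (lookup-code ρ (nbits-code (code σ))))
          ≡⟨ cong (λ n → snoc (code σ) (next-code (code σ) (lookup-code ρ n))) (nbits-code-code σ) ⟩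
        snoc (code σ) (next-code (code σ) (lookup-code ρ n))
          ≡⟨ cong (λ b → snoc (code σ) (next-code (code σ) b)) (lookup-code-↾ R (ℕ.≤-<-trans n≤j j<m)) ⟩
        snoc (code σ) (next-code (code σ) (bit (R n)))          ≡⟨ cong (snoc (code σ)) (next-code-code σ (R n)) ⟩
        snoc (code σ) (bit (nx σ (R n)))                        ≡⟨ snoc-code σ (nx σ (R n)) ⟩
        code (σ ▹ nx σ (R n))                                   ∎
        where
        open ≡-Reasoning
        σ = ψ em P R j
        n = #branchings em P σ
        n≤j : n ≤ j
        n≤j = subst (n ≤_) (∣ψ∣ R j) (#branchings≤ σ)

    br-c : Computes₁ br-code
    br-c = close₁ (app₃ cond-c (app₁ (member-▹-c false) (var 0F)) (app₁ (member-▹-c true) (var 0F)) (const-c 0))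

    nbits-c : Computes₁ nbits-code
    nbits-c = fold-c 0 (close₃ (app₂ plus-c (app₁ br-c (var 0F)) (var 2F)))

    bits-c : Computes₁ bits-code
    bits-c = fold-c 0 (close₃ (app₃ cond-c (app₁ br-c (var 0F)) (app₂ snoc-c (var 2F) (var 1F)) (var 2F)))

    next-c : Computes₂ next-code
    next-c = close₂ (app₃ cond-c (app₁ br-c (var 0F)) (var 1F) (app₁ flip-c (app₁ (member-▹-c false) (var 0F))))

    lookup-c : Computes₂ lookup-code
    lookup-c = close₂ (app₁ lastbit-c (app₂ anc-c (var 0F)
      (app₂ sub-c (app₁ length-c (var 0F)) (suc-c (var 1F)))))

    ψ-c : Computes₁ ψ-code
    ψ-c = close₁ (natrec-c (const-c 0)
      (app₂ snoc-c (var 1F) (app₂ next-c (var 1F) (app₂ lookup-c (var 2F) (app₁ nbits-c (var 1F)))))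
      (app₁ length-c (var 0F)))

  -- Transfer of tests in both directions

  randomlyProduced⇒MLR : ∀ X → X ∈ RandomlyProduced em P → X ∈ MLR T (inducedMeasure em P)
  randomlyProduced⇒MLR X (R , R∈MLR , X≗ΨR) U (e , spec) U-small X∈U =
    R∈MLR V (preimage-ceOpen ψ-c e) V-small R∈V
    where
    open Computability T

    V : ℕ → Pred Cantor 0ℓ
    V n Y = ∃[ σ ] (T ⊢ e · (n ∷ ψ-code (code σ) ∷ []) ↓) × Y ∈ ⟦ σ ⟧

    -- Whatever `Z` is, `Φ` maps the merged sequence to `Ψ em P Y`, so `lebesgue-merge` bounds the
    -- measure of `V n`.
    V⇒merge∈U : ∀ n {Y} → Y ∈ V n → ∀ Z → Φ em P (merge brφ Y Z) ∈ U n
    V⇒merge∈U n {Y} (σ , e↓ , σ≺Y) Z = Equivalence.from (spec n _) (ψ em P Y m ,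
      subst (λ c → T ⊢ e · (n ∷ c ∷ []) ↓) (trans (cong (λ ρ → ψ-code (code ρ)) (sym σ≺Y)) (ψ-code-↾ Y m)) e↓ ,
      trans (cong (Φ em P (merge brφ Y Z) ↾_) (∣ψ∣ Y m)) (Φ-merge Y Z m))
      where m = ∣ σ ∣

    V-small : ∀ n → lebesgue (V n) (2⁻ n)
    V-small n = lebesgue-mono (2⁻ n) (V⇒merge∈U n) (lebesgue-merge brφ em (2⁻ n) (U-small n))

    R∈V : ∀ n → R ∈ V n
    R∈V n = let σ , e↓ , σ≺X = Equivalence.to (spec n X) (X∈U n) ; m = ∣ σ ∣ in
      R ↾ m , subst (λ c → T ⊢ e · (n ∷ c ∷ []) ↓)
        (trans (cong code (trans (sym σ≺X) (trans (↾-cong X≗ΨR m) (Ψ-↾ em P R m)))) (sym (ψ-code-↾ R m))) e↓ ,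
      ↾-≺ R m

  -- The cylinders of strings outside `T` form a constant test: `Φ` never leaves `T`, so its
  -- preimage is empty.
  MLR⇒on-T : Satisfiable P → ∀ X → X ∈ MLR T (inducedMeasure em P) → ∀ n → X ↾ n ∈ T
  MLR⇒on-T (X₀ , X₀∈P) X X∈MLR n with em {X ↾ n ∈ T}
  ... | yes X↾n∈T = X↾n∈T
  ... | no  X↾n∉T = contradiction (λ _ → X ↾ n , X↾n∉T , ↾-≺ X n)
    (X∈MLR _ complement-ceOpen (lebesgue-∅ λ { Y (σ , σ∉T , σ≺ΦY) → σ∉T
      (subst (_∈ T) (trans (sym (Φ-↾ em P Y ∣ σ ∣)) σ≺ΦY) (φ-∈T (X₀ , X₀∈P , refl) (Y ↾ ∣ σ ∣))) }))
    where open Computability T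

  -- A test `V` that captures `R` gives a test `U` that captures `X`: a string is enumerated into
  -- `U n` when its bits are enumerated into `V n`.
  bits-MLR : ∀ {X R} → X ∈ MLR T (inducedMeasure em P) → Infinite br X →
    (∀ m → bits (X ↾ m) ≺ R) → R ∈ MLR T lebesgue
  bits-MLR {X} {R} X∈MLR inf ≺R V (e , spec) V-small R∈V =
    X∈MLR U (preimage-ceOpen bits-c e) U-small X∈U
    where
    open Computability T

    U : ℕ → Pred Cantor 0ℓ
    U n Y = ∃[ σ ] (T ⊢ e · (n ∷ bits-code (code σ) ∷ []) ↓) × Y ∈ ⟦ σ ⟧

    -- `Φ em P Y` may branch only finitely often even though `X` does not, so `Q` is taken as the
    -- limit of the live selection, which is always infinite.
    U⇒select∈V : ∀ n {Y} → Φ em P Y ∈ U n →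
      ∃[ Q ] Q ∈ V n × (∀ C → C ≺ Q → ∃[ m ] select live (Y ↾ m) ≡ C)
    U⇒select∈V n {Y} (σ , e↓ , σ≺ΦY) = Q ,
      Equivalence.from (spec n Q) (bits σ , subst (λ c → T ⊢ e · (n ∷ c ∷ []) ↓) (bits-code-code σ) e↓ , bits≺Q) ,
      select-reaches live Y (live-infinite Y) ≺Q
      where
      limit : ∃[ Q ] ∀ m → select live (Y ↾ m) ≺ Q
      limit = chain-limit (select-chain live Y) (select-unbounded live Y (live-infinite Y))
      Q = proj₁ limit
      ≺Q = proj₂ limit
      bits≺Q : bits σ ≺ Q
      bits≺Q = let k , eq , _ = bits-live Y ∣ σ ∣ in subst (_≺ Q)
        (trans (sym eq) (trans (select-φ (Y ↾ ∣ σ ∣)) (cong bits (trans (sym (Φ-↾ em P Y ∣ σ ∣)) σ≺ΦY)))) (≺Q k)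

    U-small : ∀ n → inducedMeasure em P (U n) (2⁻ n)
    U-small n = lebesgue-mono (2⁻ n) (U⇒select∈V n) (lebesgue-select live (2⁻ n) (V-small n))

    X∈U : ∀ n → X ∈ U n
    X∈U n = let ρ , e↓ , ρ≺R = Equivalence.to (spec n R) (R∈V n)
                m , eq = select-reaches br X inf ≺R ρ ρ≺R in
      X ↾ m , subst (λ c → T ⊢ e · (n ∷ c ∷ []) ↓)
        (sym (trans (bits-code-code (X ↾ m)) (cong code eq))) e↓ , ↾-≺ X m

  ¬infinite⇒ : ∀ X → ¬ Infinite br X → ∃[ m ] ∀ n → m ≤ n → br (X ↾ n) ≡ false
  ¬infinite⇒ X ¬inf with em {∃[ m ] ∀ n → m ≤ n → br (X ↾ n) ≡ false}
  ... | yes found = found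
  ... | no  ∄m    = contradiction inf ¬inf
    where
    inf : Infinite br X
    inf m with em {∃[ n ] m ≤ n × br (X ↾ n) ≡ true}
    ... | yes found = found
    ... | no  ∄n    = contradiction (m , λ n m≤n → Bool.¬-not λ eq → ∄n (n , m≤n , eq)) ∄m

  bits-prefix : ∀ X {R m n} → m ℕ.≤′ n → bits (X ↾ n) ≺ R → bits (X ↾ m) ≺ R
  bits-prefix X ℕ.≤′-refl               ≺R = ≺R
  bits-prefix X {R} (ℕ.≤′-step {n = n} m≤n) ≺R with select-chain br X n
  ... | inj₁ same       = bits-prefix X m≤n (subst (_≺ R) same ≺R)
  ... | inj₂ (b , more) = bits-prefix X m≤n (proj₁ (≺-parent (subst (_≺ R) more ≺R)))

  bits-eventually : ∀ X {m n} → (∀ n → m ≤ n → br (X ↾ n) ≡ false) → m ℕ.≤′ n → bits (X ↾ n) ≡ bits (X ↾ m)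
  bits-eventually X none-after ℕ.≤′-refl = refl
  bits-eventually X none-after (ℕ.≤′-step {n = n} m≤n) =
    trans (select-false br (X ↾ n) (X n) (none-after n (ℕ.≤′⇒≤ m≤n))) (bits-eventually X none-after m≤n)

  MLR⇒randomlyProduced : Satisfiable P → ∀ X → X ∈ MLR T (inducedMeasure em P) → X ∈ RandomlyProduced em P
  MLR⇒randomlyProduced sat X X∈MLR = by-cases em
    where
    on-T = MLR⇒on-T sat X X∈MLR

    by-cases : Dec (Infinite br X) → X ∈ RandomlyProduced em P
    by-cases (yes inf) = R , bits-MLR X∈MLR inf ≺R , bits-≺⇒Ψ on-T ≺R
      where
      limit : ∃[ R ] ∀ m → bits (X ↾ m) ≺ R
      limit = chain-limit (select-chain br X) (select-unbounded br X inf)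
      R = proj₁ limit
      ≺R = proj₂ limit
    -- The bits of `X` are constant from `m` on, so any random `R` extending them produces `X`.
    by-cases (no ¬inf) =
      let m , none-after  = ¬infinite⇒ X ¬inf
          R , ≺R , R∈MLR = random-extending em T (bits (X ↾ m))
      in R , R∈MLR , bits-≺⇒Ψ on-T (all-≺ m none-after ≺R)
      where
      all-≺ : ∀ m → (∀ n → m ≤ n → br (X ↾ n) ≡ false) → ∀ {R} → bits (X ↾ m) ≺ R → ∀ n → bits (X ↾ n) ≺ R
      all-≺ m none-after {R} ≺R n with ℕ.≤-total m n
      ... | inj₁ m≤n = subst (_≺ R) (sym (bits-eventually X none-after (ℕ.≤⇒≤′ m≤n))) ≺R
      ... | inj₂ n≤m = bits-prefix X (ℕ.≤⇒≤′ n≤m) ≺R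

theorem3p3 : (em : ExcludedMiddle 0ℓ) (P : Pred Cantor 0ℓ) →
    IsΠ⁰₁ P → Satisfiable P →
    (X : Cantor) → X ∈ RandomlyProduced em P ⇔ X ∈ MLR T⟨ P ⟩ (inducedMeasure em P)
theorem3p3 em P _ sat X = mk⇔ (randomlyProduced⇒MLR em P X) (MLR⇒randomlyProduced em P sat X)
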